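{- There exist polytopes $\mathcal{D}\subseteq\mathbb{R}^d_{\ge0}$ (for arbitrarily large $d$) such that any $O(\log d)$-approximate portfolio over $\mathcal{D}$ for the class of ordered norms must have size $d^{\Omega(1/\log\log d)}$. The same bound holds for the class of symmetric monotonic norms. Explicitly: there is a family of polytopes $\mathcal{D}_d\subseteq\mathbb{R}^d_{\ge0}$, for a sequence of $d\to\infty$, such that for every constant $K>0$ there is $c>0$ such that for all sufficiently large $d$ in the sequence, every $(K\log d)$-approximate portfolio over $\mathcal{D}_d$ for ordered norms (respectively, for symmetric monotonic norms) has size at least $d^{c/\log\log d}$.
   Context: For $x\in\mathbb{R}^d$, $|x|^{\downarrow}$ is the vector of absolute values of coordinates of $x$ sorted in decreasing order. A weight vector is a nonzero $w\in\mathbb{R}^d$ with $w_1\ge\dots\ge w_d\ge 0$; the ordered norm is $\|x\|_{(w)}=w^\top|x|^{\downarrow}$. A symmetric monotonic norm on $\mathbb{R}^d$ is a norm invariant under permutations of coordinates and nondecreasing in each coordinate (on the nonnegative orthant). Given $\mathcal{D}\subseteq\mathbb{R}^d_{\ge0}$, a class $\mathbf{C}$ of functions $\mathcal{D}\to\mathbb{R}_{\ge 0}$ and $\alpha\ge 1$, a set $X\subseteq\mathcal{D}$ is an $\alpha$-approximate portfolio for $\mathbf{C}$ over $\mathcal{D}$ if $\min_{x\in X}f(x)\le\alpha\min_{x\in\mathcal{D}}f(x)$ for every $f\in\mathbf{C}$. -}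

module Defs where

open import Data.Fin using (Fin; zero; suc)
open import Data.Fin.Permutation using (Permutation′; _⟨$⟩ʳ_)
open import Data.Integer as ℤ using (+_)
open import Data.Integer.Properties as ℤₚ using ()
open import Data.Nat as ℕ using (ℕ; zero; suc)
open import Data.Nat.Induction using (<-rec)
open import Data.Nat.Logarithm using
  (⌊log₂_⌋; ⌊log₂⌋-mono-≤; ⌊log₂[2^n]⌋≡n; ⌊log₂⌊n/2⌋⌋≡⌊log₂n⌋∸1)
open import Data.Nat.Properties as ℕₚ using ()
open import Data.Product using (Σ; ∃; ∃₂; ∃-syntax; _×_; _,_; proj₁; proj₂)
open import Data.Rational as ℚ using (ℚ; 0ℚ; 1ℚ; ½; ↥_; ↧ₙ_; toℚᵘ)
open import Data.Rational.Properties as ℚₚ using ()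
import Data.Rational.Unnormalised as ℚᵘ
import Data.Rational.Unnormalised.Properties as ℚᵘₚ
open import Data.Sum using (inj₁; inj₂)
open import Data.Vec.Functional using (Vector; []; _∷_; head; tail; map; foldr; zipWith)
open import Function.Bundles using (_⇔_)
open import Level using (0ℓ)
open import Relation.Binary.PropositionalEquality
open import Relation.Nullary using (¬_; yes; no; contradiction)
open import Relation.Unary using (Pred; _∈_; _⊆_)

import Data.Nat.Solver as ℕSolver
import Data.Rational.Solver as ℚSolver

module NatLog where
  open import Data.Nat using (_+_; _*_; _^_; _≤_; _<_; _/_; _∸_; z≤n; s≤s; NonZero; ⌊_/2⌋)
  open import Data.Nat.Properties
  open import Data.Nat.DivMod using (m/n*n≤m; m≡m%n+[m/n]*n; m%n<n; m≥n⇒m/n>0)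
  open ℕSolver.+-*-Solver

  2^⌊log₂⌋≤ : ∀ n → 1 ≤ n → 2 ^ ⌊log₂ n ⌋ ≤ n
  2^⌊log₂⌋≤ = <-rec (λ n → 1 ≤ n → 2 ^ ⌊log₂ n ⌋ ≤ n) step
    where
    open ≤-Reasoning
    ⌊n/2⌋+⌊n/2⌋≤n : ∀ n → 2 * ⌊ n /2⌋ ≤ n
    ⌊n/2⌋+⌊n/2⌋≤n n = begin
      2 * ⌊ n /2⌋           ≡⟨ cong (λ k → ⌊ n /2⌋ + k) (+-identityʳ ⌊ n /2⌋) ⟩
      ⌊ n /2⌋ + ⌊ n /2⌋     ≤⟨ +-monoʳ-≤ ⌊ n /2⌋ (⌊n/2⌋≤⌈n/2⌉ n) ⟩
      ⌊ n /2⌋ + ℕ.⌈ n /2⌉   ≡⟨ ⌊n/2⌋+⌈n/2⌉≡n n ⟩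
      n                     ∎
    step : ∀ n → (∀ {m} → m < n → 1 ≤ m → 2 ^ ⌊log₂ m ⌋ ≤ m) →
           1 ≤ n → 2 ^ ⌊log₂ n ⌋ ≤ n
    step 1 rec _ = ≤-refl
    step n@(suc (suc k)) rec _ = begin
      2 ^ ⌊log₂ n ⌋               ≡⟨ cong (2 ^_) (sym (m+[n∸m]≡n
                                       (⌊log₂⌋-mono-≤ {2} {n} (s≤s (s≤s z≤n))))) ⟩
      2 * 2 ^ (⌊log₂ n ⌋ ∸ 1)     ≡⟨ cong (λ e → 2 * 2 ^ e) (sym (⌊log₂⌊n/2⌋⌋≡⌊log₂n⌋∸1 n)) ⟩
      2 * 2 ^ ⌊log₂ ⌊ n /2⌋ ⌋     ≤⟨ *-monoʳ-≤ 2 (rec (⌊n/2⌋<n (suc k)) (s≤s z≤n)) ⟩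
      2 * ⌊ n /2⌋                 ≤⟨ ⌊n/2⌋+⌊n/2⌋≤n n ⟩
      n                           ∎

  <2^1+⌊log₂⌋ : ∀ n → n < 2 ^ (1 + ⌊log₂ n ⌋)
  <2^1+⌊log₂⌋ n = ≰⇒> λ h → <-irrefl refl (begin-strict
    ⌊log₂ n ⌋                     <⟨ n<1+n _ ⟩
    1 + ⌊log₂ n ⌋                 ≡⟨ sym (⌊log₂[2^n]⌋≡n (1 + ⌊log₂ n ⌋)) ⟩
    ⌊log₂ (2 ^ (1 + ⌊log₂ n ⌋)) ⌋ ≤⟨ ⌊log₂⌋-mono-≤ h ⟩
    ⌊log₂ n ⌋                     ∎)
    where open ≤-Reasoning

  module _ (p r : ℕ) .{{_ : NonZero r}} where
    open ≤-Reasoning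
    2^⌊log₂/⌋*r≤p : r ≤ p → 2 ^ ⌊log₂ (p / r) ⌋ * r ≤ p
    2^⌊log₂/⌋*r≤p r≤p = begin
      2 ^ ⌊log₂ (p / r) ⌋ * r ≤⟨ *-monoˡ-≤ r (2^⌊log₂⌋≤ (p / r) (m≥n⇒m/n>0 r≤p)) ⟩
      p / r * r               ≤⟨ m/n*n≤m p r ⟩
      p                       ∎

    p≤2^1+⌊log₂/⌋*r : p ≤ 2 ^ (1 + ⌊log₂ (p / r) ⌋) * r
    p≤2^1+⌊log₂/⌋*r = begin
      p                               ≡⟨ m≡m%n+[m/n]*n p r ⟩
      p ℕ.% r + p / r * r             ≤⟨ +-monoˡ-≤ (p / r * r) (<⇒≤ (m%n<n p r)) ⟩
      (1 + p / r) * r                 ≤⟨ *-monoˡ-≤ r (<2^1+⌊log₂⌋ (p / r)) ⟩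
      2 ^ (1 + ⌊log₂ (p / r) ⌋) * r   ∎

  ^-distribʳ-* : ∀ m n k → (m * n) ^ k ≡ m ^ k * n ^ k
  ^-distribʳ-* m n zero    = refl
  ^-distribʳ-* m n (suc k) = trans (cong (m * n *_) (^-distribʳ-* m n k))
    (solve 4 (λ m n a b → m :* n :* (a :* b) := m :* a :* (n :* b)) refl m n (m ^ k) (n ^ k))

  -- (1 + 1/2t)ᵗ ≤ 2
  1+1/2t^t : ∀ t → 1 ≤ t → (1 + 2 * t) ^ t ≤ 2 * (2 * t) ^ t
  1+1/2t^t t@(suc _) _ = *-cancelʳ-≤ _ _ t (begin
    (1 + 2 * t) ^ t * t   ≤⟨ go t ≤-refl t (cong (λ k → t + k) (sym (+-identityʳ t))) ⟩
    2 * t * (2 * t) ^ t   ≡⟨ solve 3 (λ a t x → a :* t :* x := a :* x :* t) refl 2 t ((2 * t) ^ t) ⟩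
    2 * (2 * t) ^ t * t   ∎)
    where
    open ≤-Reasoning
    go : ∀ s → s ≤ t → ∀ u → s + u ≡ 2 * t → (1 + 2 * t) ^ s * u ≤ 2 * t * (2 * t) ^ s
    go zero _ u refl = ≤-reflexive (trans (*-identityˡ _) (sym (*-identityʳ _)))
    go (suc s) s<t u eq = begin
      (1 + 2 * t) * (1 + 2 * t) ^ s * u
        ≡⟨ solve 3 (λ a b u → a :* b :* u := b :* (a :* u)) refl
             (1 + 2 * t) ((1 + 2 * t) ^ s) u ⟩
      (1 + 2 * t) ^ s * ((1 + 2 * t) * u)
        ≤⟨ *-monoʳ-≤ ((1 + 2 * t) ^ s) (begin
             u + 2 * t * u       ≤⟨ +-monoˡ-≤ (2 * t * u) (subst (u ≤_) eq (m≤n+m u (suc s))) ⟩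
             2 * t + 2 * t * u   ≡⟨ sym (*-suc (2 * t) u) ⟩
             2 * t * suc u       ∎) ⟩
      (1 + 2 * t) ^ s * (2 * t * suc u)
        ≡⟨ solve 3 (λ a b u → b :* (a :* u) := a :* (b :* u)) refl
             (2 * t) ((1 + 2 * t) ^ s) (suc u) ⟩
      2 * t * ((1 + 2 * t) ^ s * suc u)
        ≤⟨ *-monoʳ-≤ (2 * t) (go s (<⇒≤ s<t) (suc u) (trans (+-suc s u) eq)) ⟩
      2 * t * (2 * t * (2 * t) ^ s) ∎

  2^-cancel-≤ : ∀ {m n} → 2 ^ m ≤ 2 ^ n → m ≤ n
  2^-cancel-≤ {m} {n} h = ≮⇒≥ λ n<m → <⇒≱ (^-monoʳ-< 2 (s≤s (s≤s z≤n)) n<m) h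

  -- If 2ᶠ ≤ (p/r)ᴺ, (p′/r′)ᴹ ≤ 2ᵍ and p/r ≤ (1 + 1/2t) p′/r′, then f/N ≤ g/M + 1/t.
  compare : ∀ {p r p′ r′ f g N M t} .{{_ : NonZero r}} .{{_ : NonZero r′}} → 1 ≤ t →
    2 ^ f * r ^ N ≤ p ^ N → p′ ^ M ≤ 2 ^ g * r′ ^ M →
    2 * t * (p * r′) ≤ (1 + 2 * t) * (p′ * r) →
    f * M * t ≤ N * M + g * N * t
  compare {p} {r} {p′} {r′} {f} {g} {N} {M} {t@(suc _)} 1≤t lo hi h =
    2^-cancel-≤ (*-cancelʳ-≤ _ _ ((2 * t) ^ (N * M * t) )
      {{m^n≢0 (2 * t) (N * M * t)}} (begin
      2 ^ (f * M * t) * A ^ (N * M * t)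
        ≡⟨ cong₂ _*_ (sym (^-*-assoc 2 (f * M) t)) (sym (^-*-assoc A (N * M) t)) ⟩
      (2 ^ (f * M)) ^ t * (A ^ (N * M)) ^ t
        ≡⟨ sym (^-distribʳ-* (2 ^ (f * M)) (A ^ (N * M)) t) ⟩
      (2 ^ (f * M) * A ^ (N * M)) ^ t
        ≤⟨ ^-monoˡ-≤ t main ⟩
      (2 ^ (g * N) * B ^ (N * M)) ^ t
        ≡⟨ ^-distribʳ-* (2 ^ (g * N)) (B ^ (N * M)) t ⟩
      (2 ^ (g * N)) ^ t * (B ^ (N * M)) ^ t
        ≡⟨ cong₂ _*_ (^-*-assoc 2 (g * N) t) (trans (^-*-assoc B (N * M) t)
             (trans (cong (B ^_) (*-comm (N * M) t)) (sym (^-*-assoc B t (N * M))))) ⟩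
      2 ^ (g * N * t) * (B ^ t) ^ (N * M)
        ≤⟨ *-monoʳ-≤ (2 ^ (g * N * t)) (^-monoˡ-≤ (N * M) (1+1/2t^t t 1≤t)) ⟩
      2 ^ (g * N * t) * (2 * A ^ t) ^ (N * M)
        ≡⟨ cong (2 ^ (g * N * t) *_) (trans (^-distribʳ-* 2 (A ^ t) (N * M))
             (cong (2 ^ (N * M) *_) (trans (^-*-assoc A t (N * M))
               (cong (A ^_) (*-comm t (N * M)))))) ⟩
      2 ^ (g * N * t) * (2 ^ (N * M) * A ^ (N * M * t))
        ≡⟨ solve 3 (λ a b c → a :* (b :* c) := b :* a :* c) refl
             (2 ^ (g * N * t)) (2 ^ (N * M)) (A ^ (N * M * t)) ⟩
      2 ^ (N * M) * 2 ^ (g * N * t) * A ^ (N * M * t)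
        ≡⟨ cong (_* A ^ (N * M * t)) (sym (^-distribˡ-+-* 2 (N * M) (g * N * t))) ⟩
      2 ^ (N * M + g * N * t) * A ^ (N * M * t) ∎))
    where
    open ≤-Reasoning
    A B : ℕ
    A = 2 * t
    B = 1 + 2 * t
    lo′ : 2 ^ (f * M) * r ^ (N * M) ≤ p ^ (N * M)
    lo′ = begin
      2 ^ (f * M) * r ^ (N * M)   ≡⟨ cong₂ _*_ (sym (^-*-assoc 2 f M)) (sym (^-*-assoc r N M)) ⟩
      (2 ^ f) ^ M * (r ^ N) ^ M   ≡⟨ sym (^-distribʳ-* (2 ^ f) (r ^ N) M) ⟩
      (2 ^ f * r ^ N) ^ M         ≤⟨ ^-monoˡ-≤ M lo ⟩
      (p ^ N) ^ M                 ≡⟨ ^-*-assoc p N M ⟩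
      p ^ (N * M)                 ∎
    hi′ : p′ ^ (N * M) ≤ 2 ^ (g * N) * r′ ^ (N * M)
    hi′ = begin
      p′ ^ (N * M)                 ≡⟨ cong (p′ ^_) (*-comm N M) ⟩
      p′ ^ (M * N)                 ≡⟨ sym (^-*-assoc p′ M N) ⟩
      (p′ ^ M) ^ N                 ≤⟨ ^-monoˡ-≤ N hi ⟩
      (2 ^ g * r′ ^ M) ^ N         ≡⟨ ^-distribʳ-* (2 ^ g) (r′ ^ M) N ⟩
      (2 ^ g) ^ N * (r′ ^ M) ^ N   ≡⟨ cong₂ _*_ (^-*-assoc 2 g N)
                                        (trans (^-*-assoc r′ M N) (cong (r′ ^_) (*-comm M N))) ⟩
      2 ^ (g * N) * r′ ^ (N * M)   ∎
    main : 2 ^ (f * M) * A ^ (N * M) ≤ 2 ^ (g * N) * B ^ (N * M)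
    main = *-cancelʳ-≤ _ _ (r ^ K * r′ ^ K)
      {{m*n≢0 (r ^ K) (r′ ^ K) {{m^n≢0 r K}} {{m^n≢0 r′ K}}}} (begin
      2 ^ (f * M) * A ^ K * (r ^ K * r′ ^ K)
        ≡⟨ solve 4 (λ a b c d → a :* b :* (c :* d) := b :* (a :* c :* d)) refl
             (2 ^ (f * M)) (A ^ K) (r ^ K) (r′ ^ K) ⟩
      A ^ K * (2 ^ (f * M) * r ^ K * r′ ^ K)
        ≤⟨ *-monoʳ-≤ (A ^ K) (*-monoˡ-≤ (r′ ^ K) lo′) ⟩
      A ^ K * (p ^ K * r′ ^ K)
        ≡⟨ trans (cong (A ^ K *_) (sym (^-distribʳ-* p r′ K))) (sym (^-distribʳ-* A (p * r′) K)) ⟩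
      (A * (p * r′)) ^ K
        ≤⟨ ^-monoˡ-≤ K h ⟩
      (B * (p′ * r)) ^ K
        ≡⟨ trans (^-distribʳ-* B (p′ * r) K) (cong (B ^ K *_) (^-distribʳ-* p′ r K)) ⟩
      B ^ K * (p′ ^ K * r ^ K)
        ≤⟨ *-monoʳ-≤ (B ^ K) (*-monoˡ-≤ (r ^ K) hi′) ⟩
      B ^ K * (2 ^ (g * N) * r′ ^ K * r ^ K)
        ≡⟨ solve 4 (λ a b c d → b :* (a :* d :* c) := a :* b :* (c :* d)) refl
             (2 ^ (g * N)) (B ^ K) (r ^ K) (r′ ^ K) ⟩
      2 ^ (g * N) * B ^ K * (r ^ K * r′ ^ K) ∎)
      where
      K : ℕ
      K = N * M

-- Since m and n are interchangeable, this is |s m - s n| ≤ ε for all m, n ≥ N.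
Cauchy : (ℕ → ℚ) → Set
Cauchy s = ∀ ε → 0ℚ ℚ.< ε →
  ∃[ N ] (∀ m n → N ℕ.≤ m → N ℕ.≤ n → s m ℚ.≤ s n ℚ.+ ε)

record ℝ : Set where
  constructor mkℝ
  field
    seq    : ℕ → ℚ
    cauchy : Cauchy seq

open ℝ public

infix 4 _≤_ _<_ _≃_

_≤_ : ℝ → ℝ → Set
x ≤ y = ∀ ε → 0ℚ ℚ.< ε →
  ∃[ N ] (∀ n → N ℕ.≤ n → seq x n ℚ.≤ seq y n ℚ.+ ε)

_<_ : ℝ → ℝ → Set
x < y = ∃[ ε ] (0ℚ ℚ.< ε ×
  ∃[ N ] (∀ n → N ℕ.≤ n → seq x n ℚ.+ ε ℚ.≤ seq y n))

_≃_ : ℝ → ℝ → Set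
x ≃ y = x ≤ y × y ≤ x

abstract
  const-cauchy : ∀ q → Cauchy (λ _ → q)
  const-cauchy q ε 0<ε = 0 , λ _ _ _ _ →
    subst (ℚ._≤ q ℚ.+ ε) (ℚₚ.+-identityʳ q) (ℚₚ.+-monoʳ-≤ q (ℚₚ.<⇒≤ 0<ε))

fromℚ : ℚ → ℝ
fromℚ q = mkℝ (λ _ → q) (const-cauchy q)

fromℕ : ℕ → ℝ
fromℕ n = fromℚ (+ n ℚ./ 1)

0ℝ 1ℝ : ℝ
0ℝ = fromℕ 0
1ℝ = fromℕ 1

half-pos : ∀ {ε} → 0ℚ ℚ.< ε → 0ℚ ℚ.< ½ ℚ.* ε
half-pos {ε} 0<ε = subst (ℚ._< ½ ℚ.* ε) (ℚₚ.*-zeroʳ ½) (ℚₚ.*-monoʳ-<-pos ½ 0<ε)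

half+half : ∀ ε → ½ ℚ.* ε ℚ.+ ½ ℚ.* ε ≡ ε
half+half ε = trans (sym (ℚₚ.*-distribʳ-+ ε ½ ½)) (ℚₚ.*-identityˡ ε)

⊔-≤ˡ : ∀ {a b c} → a ℕ.⊔ b ℕ.≤ c → a ℕ.≤ c
⊔-≤ˡ {a} {b} = ℕₚ.≤-trans (ℕₚ.m≤m⊔n a b)

⊔-≤ʳ : ∀ {a b c} → a ℕ.⊔ b ℕ.≤ c → b ℕ.≤ c
⊔-≤ʳ {a} {b} = ℕₚ.≤-trans (ℕₚ.m≤n⊔m a b)

infix  8 -_
infixl 7 _*_ _⊓_
infixl 6 _+_ _⊔_

abstract
  +-cauchy : ∀ x y → Cauchy (λ n → seq x n ℚ.+ seq y n)
  +-cauchy x y ε 0<ε =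
    let (M , p) = cauchy x (½ ℚ.* ε) (half-pos 0<ε)
        (N , q) = cauchy y (½ ℚ.* ε) (half-pos 0<ε)
    in M ℕ.⊔ N , λ m n m≥ n≥ → begin
      seq x m ℚ.+ seq y m
        ≤⟨ ℚₚ.+-mono-≤ (p m n (⊔-≤ˡ m≥) (⊔-≤ˡ n≥)) (q m n (⊔-≤ʳ {M} m≥) (⊔-≤ʳ {M} n≥)) ⟩
      (seq x n ℚ.+ ½ ℚ.* ε) ℚ.+ (seq y n ℚ.+ ½ ℚ.* ε)
        ≡⟨ solve 3 (λ a b e → (a :+ e) :+ (b :+ e) := (a :+ b) :+ (e :+ e)) refl
             (seq x n) (seq y n) (½ ℚ.* ε) ⟩
      (seq x n ℚ.+ seq y n) ℚ.+ (½ ℚ.* ε ℚ.+ ½ ℚ.* ε)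
        ≡⟨ cong (seq x n ℚ.+ seq y n ℚ.+_) (half+half ε) ⟩
      (seq x n ℚ.+ seq y n) ℚ.+ ε ∎
    where
    open ℚₚ.≤-Reasoning
    open ℚSolver.+-*-Solver

_+_ : ℝ → ℝ → ℝ
x + y = mkℝ (λ n → seq x n ℚ.+ seq y n) (+-cauchy x y)

abstract
  neg-cauchy : ∀ x → Cauchy (λ n → ℚ.- seq x n)
  neg-cauchy x ε 0<ε =
    let (N , p) = cauchy x ε 0<ε
    in N , λ m n m≥ n≥ → begin
      ℚ.- seq x m
        ≡⟨ solve 2 (λ a e → :- a := :- (a :+ e) :+ e) refl (seq x m) ε ⟩
      ℚ.- (seq x m ℚ.+ ε) ℚ.+ ε
        ≤⟨ ℚₚ.+-monoˡ-≤ ε (ℚₚ.neg-antimono-≤ (p n m n≥ m≥)) ⟩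
      ℚ.- seq x n ℚ.+ ε ∎
    where
    open ℚₚ.≤-Reasoning
    open ℚSolver.+-*-Solver

-_ : ℝ → ℝ
- x = mkℝ (λ n → ℚ.- seq x n) (neg-cauchy x)

abstract
  ⊔-cauchy : ∀ x y → Cauchy (λ n → seq x n ℚ.⊔ seq y n)
  ⊔-cauchy x y ε 0<ε =
    let (M , p) = cauchy x ε 0<ε
        (N , q) = cauchy y ε 0<ε
    in M ℕ.⊔ N , λ m n m≥ n≥ → ℚₚ.⊔-lub
      (ℚₚ.≤-trans (p m n (⊔-≤ˡ m≥) (⊔-≤ˡ n≥))
        (ℚₚ.+-monoˡ-≤ ε (ℚₚ.p≤p⊔q (seq x n) (seq y n))))
      (ℚₚ.≤-trans (q m n (⊔-≤ʳ {M} m≥) (⊔-≤ʳ {M} n≥))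
        (ℚₚ.+-monoˡ-≤ ε (ℚₚ.p≤q⊔p (seq x n) (seq y n))))

_⊔_ : ℝ → ℝ → ℝ
x ⊔ y = mkℝ (λ n → seq x n ℚ.⊔ seq y n) (⊔-cauchy x y)

abstract
  ⊓-cauchy : ∀ x y → Cauchy (λ n → seq x n ℚ.⊓ seq y n)
  ⊓-cauchy x y ε 0<ε =
    let (M , p) = cauchy x ε 0<ε
        (N , q) = cauchy y ε 0<ε
    in M ℕ.⊔ N , λ m n m≥ n≥ →
      subst (seq x m ℚ.⊓ seq y m ℚ.≤_)
        (sym (ℚₚ.mono-≤-distrib-⊓ (ℚₚ.+-monoˡ-≤ ε) (seq x n) (seq y n)))
        (ℚₚ.⊓-glb
          (ℚₚ.≤-trans (ℚₚ.p⊓q≤p (seq x m) (seq y m)) (p m n (⊔-≤ˡ m≥) (⊔-≤ˡ n≥)))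
          (ℚₚ.≤-trans (ℚₚ.p⊓q≤q (seq x m) (seq y m)) (q m n (⊔-≤ʳ {M} m≥) (⊔-≤ʳ {M} n≥))))

_⊓_ : ℝ → ℝ → ℝ
x ⊓ y = mkℝ (λ n → seq x n ℚ.⊓ seq y n) (⊓-cauchy x y)

∣_∣ : ℝ → ℝ
∣ x ∣ = x ⊔ - x

abs-≤ : ∀ {a b} → a ℚ.≤ b → ℚ.- a ℚ.≤ b → ℚ.∣ a ∣ ℚ.≤ b
abs-≤ {a} a≤b -a≤b with ℚₚ.∣p∣≡p∨∣p∣≡-p a
... | inj₁ e = subst (ℚ._≤ _) (sym e) a≤b
... | inj₂ e = subst (ℚ._≤ _) (sym e) -a≤b

≤-abs : ∀ a → a ℚ.≤ ℚ.∣ a ∣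
≤-abs a with ℚₚ.≤-total 0ℚ a
... | inj₁ 0≤a = ℚₚ.≤-reflexive (sym (ℚₚ.0≤p⇒∣p∣≡p 0≤a))
... | inj₂ a≤0 = ℚₚ.≤-trans a≤0 (ℚₚ.0≤∣p∣ a)

≤+⇒-≤ : ∀ {a b ε} → a ℚ.≤ b ℚ.+ ε → a ℚ.- b ℚ.≤ ε
≤+⇒-≤ {a} {b} {ε} h = begin
  a ℚ.- b           ≤⟨ ℚₚ.+-monoˡ-≤ (ℚ.- b) h ⟩
  b ℚ.+ ε ℚ.- b     ≡⟨ solve 2 (λ b e → b :+ e :- b := e) refl b ε ⟩
  ε                 ∎
  where
  open ℚₚ.≤-Reasoning
  open ℚSolver.+-*-Solver

close : ∀ {a b ε} → a ℚ.≤ b ℚ.+ ε → b ℚ.≤ a ℚ.+ ε → ℚ.∣ a ℚ.- b ∣ ℚ.≤ ε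
close {a} {b} {ε} h k = abs-≤ (≤+⇒-≤ h)
  (subst (ℚ._≤ ε) (solve 2 (λ a b → b :- a := :- (a :- b)) refl a b) (≤+⇒-≤ k))
  where open ℚSolver.+-*-Solver

0<1 : 0ℚ ℚ.< 1ℚ
0<1 = ℚₚ.positive⁻¹ 1ℚ

bounded : ∀ x → ∃₂ λ B N → 0ℚ ℚ.< B × (∀ n → N ℕ.≤ n → ℚ.∣ seq x n ∣ ℚ.≤ B)
bounded x = let (N , p) = cauchy x 1ℚ 0<1; a = seq x N in
  ℚ.∣ a ∣ ℚ.+ 1ℚ , N ,
  ℚₚ.+-mono-≤-< (ℚₚ.0≤∣p∣ a) 0<1 ,
  λ n n≥ → begin
    ℚ.∣ seq x n ∣
      ≡⟨ cong ℚ.∣_∣ (solve 2 (λ a b → b := a :+ (b :- a)) refl a (seq x n)) ⟩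
    ℚ.∣ a ℚ.+ (seq x n ℚ.- a) ∣
      ≤⟨ ℚₚ.∣p+q∣≤∣p∣+∣q∣ a (seq x n ℚ.- a) ⟩
    ℚ.∣ a ∣ ℚ.+ ℚ.∣ seq x n ℚ.- a ∣
      ≤⟨ ℚₚ.+-monoʳ-≤ ℚ.∣ a ∣ (close (p n N n≥ ℕₚ.≤-refl) (p N n ℕₚ.≤-refl n≥)) ⟩
    ℚ.∣ a ∣ ℚ.+ 1ℚ ∎
  where
  open ℚₚ.≤-Reasoning
  open ℚSolver.+-*-Solver

*-mono : ∀ {a b c d} → 0ℚ ℚ.≤ a → 0ℚ ℚ.≤ d → a ℚ.≤ b → c ℚ.≤ d → a ℚ.* c ℚ.≤ b ℚ.* d
*-mono {a} {b} {c} {d} 0≤a 0≤d a≤b c≤d = ℚₚ.≤-trans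
  (ℚₚ.*-monoˡ-≤-nonNeg a {{ℚ.nonNegative 0≤a}} c≤d)
  (ℚₚ.*-monoʳ-≤-nonNeg d {{ℚ.nonNegative 0≤d}} a≤b)

product-bound : ∀ {a b B d} → 0ℚ ℚ.≤ d → ℚ.∣ a ∣ ℚ.≤ B → ℚ.∣ b ∣ ℚ.≤ d →
                a ℚ.* b ℚ.≤ B ℚ.* d
product-bound {a} {b} {B} {d} 0≤d h k = begin
  a ℚ.* b               ≤⟨ ≤-abs (a ℚ.* b) ⟩
  ℚ.∣ a ℚ.* b ∣         ≡⟨ ℚₚ.∣p*q∣≡∣p∣*∣q∣ a b ⟩
  ℚ.∣ a ∣ ℚ.* ℚ.∣ b ∣   ≤⟨ *-mono (ℚₚ.0≤∣p∣ a) 0≤d h k ⟩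
  B ℚ.* d               ∎
  where open ℚₚ.≤-Reasoning

scale : ∀ {C ε} → 0ℚ ℚ.< C → 0ℚ ℚ.< ε → ∃[ δ ] (0ℚ ℚ.< δ × C ℚ.* δ ≡ ε)
scale {C} {ε} 0<C 0<ε = C⁻¹ ℚ.* ε ,
  ℚₚ.positive⁻¹ (C⁻¹ ℚ.* ε) {{ℚₚ.pos*pos⇒pos C⁻¹ {{ℚₚ.1/pos⇒pos C}} ε}} ,
  trans (sym (ℚₚ.*-assoc C C⁻¹ ε))
    (trans (cong (ℚ._* ε) (ℚₚ.*-inverseʳ C)) (ℚₚ.*-identityˡ ε))
  where
  instance
    C-pos : ℚ.Positive C
    C-pos = ℚ.positive 0<C
    C-nz : ℚ.NonZero C
    C-nz = ℚ.>-nonZero 0<C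
    ε-pos : ℚ.Positive ε
    ε-pos = ℚ.positive 0<ε
  C⁻¹ : ℚ
  C⁻¹ = ℚ.1/ C

abstract
  *-cauchy : ∀ x y → Cauchy (λ n → seq x n ℚ.* seq y n)
  *-cauchy x y ε 0<ε =
    let (A , K , 0<A , a) = bounded x
        (B , L , 0<B , b) = bounded y
        (δ , 0<δ , eq)    = scale (ℚₚ.+-mono-< 0<A 0<B) 0<ε
        0≤δ               = ℚₚ.<⇒≤ 0<δ
        (M , p)           = cauchy x δ 0<δ
        (N , q)           = cauchy y δ 0<δ
    in (K ℕ.⊔ L) ℕ.⊔ (M ℕ.⊔ N) , λ m n m≥ n≥ →
    let m≥M = ⊔-≤ˡ (⊔-≤ʳ {K ℕ.⊔ L} m≥)
        n≥M = ⊔-≤ˡ (⊔-≤ʳ {K ℕ.⊔ L} n≥)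
        m≥N = ⊔-≤ʳ {M} (⊔-≤ʳ {K ℕ.⊔ L} m≥)
        n≥N = ⊔-≤ʳ {M} (⊔-≤ʳ {K ℕ.⊔ L} n≥)
        u = seq x m; v = seq y m; u′ = seq x n; v′ = seq y n
    in begin
      u ℚ.* v
        ≡⟨ solve 4 (λ u v u′ v′ →
             u :* v := u′ :* v′ :+ (u :* (v :- v′) :+ v′ :* (u :- u′))) refl u v u′ v′ ⟩
      u′ ℚ.* v′ ℚ.+ (u ℚ.* (v ℚ.- v′) ℚ.+ v′ ℚ.* (u ℚ.- u′))
        ≤⟨ ℚₚ.+-monoʳ-≤ (u′ ℚ.* v′) (ℚₚ.+-mono-≤
             (product-bound {u} {v ℚ.- v′} 0≤δ (a m (⊔-≤ˡ (⊔-≤ˡ m≥)))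
               (close (q m n m≥N n≥N) (q n m n≥N m≥N)))
             (product-bound {v′} {u ℚ.- u′} 0≤δ (b n (⊔-≤ʳ {K} (⊔-≤ˡ n≥)))
               (close (p m n m≥M n≥M) (p n m n≥M m≥M)))) ⟩
      u′ ℚ.* v′ ℚ.+ (A ℚ.* δ ℚ.+ B ℚ.* δ)
        ≡⟨ cong (u′ ℚ.* v′ ℚ.+_) (trans (sym (ℚₚ.*-distribʳ-+ δ A B)) eq) ⟩
      u′ ℚ.* v′ ℚ.+ ε ∎
    where
    open ℚₚ.≤-Reasoning
    open ℚSolver.+-*-Solver

_*_ : ℝ → ℝ → ℝ
x * y = mkℝ (λ n → seq x n ℚ.* seq y n) (*-cauchy x y)

mkℚᵘ-≤ : ∀ {a b c d} → a ℕ.* suc d ℕ.≤ c ℕ.* suc b →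
         ℚᵘ.mkℚᵘ (+ a) b ℚᵘ.≤ ℚᵘ.mkℚᵘ (+ c) d
mkℚᵘ-≤ {a} {b} {c} {d} h = ℚᵘ.*≤*
  (subst₂ ℤ._≤_ (ℤₚ.pos-* a (suc d)) (ℤₚ.pos-* c (suc b)) (ℤ.+≤+ h))

drop-mkℚᵘ-≤ : ∀ {a b c d} → ℚᵘ.mkℚᵘ (+ a) b ℚᵘ.≤ ℚᵘ.mkℚᵘ (+ c) d →
              a ℕ.* suc d ℕ.≤ c ℕ.* suc b
drop-mkℚᵘ-≤ {a} {b} {c} {d} (ℚᵘ.*≤* h) = ℤₚ.drop‿+≤+
  (subst₂ ℤ._≤_ (sym (ℤₚ.pos-* a (suc d))) (sym (ℤₚ.pos-* c (suc b))) h)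

1/-antitone : ∀ {t m} → suc t ℕ.≤ suc m → + 1 ℚ./ suc m ℚ.≤ + 1 ℚ./ suc t
1/-antitone {t} {m} h = ℚₚ.toℚᵘ-cancel-≤ (begin
  toℚᵘ (+ 1 ℚ./ suc m)   ≃⟨ ℚₚ.toℚᵘ-fromℚᵘ (ℚᵘ.mkℚᵘ (+ 1) m) ⟩
  ℚᵘ.mkℚᵘ (+ 1) m        ≤⟨ mkℚᵘ-≤ (ℕₚ.*-monoʳ-≤ 1 h) ⟩
  ℚᵘ.mkℚᵘ (+ 1) t        ≃⟨ ℚᵘₚ.≃-sym (ℚₚ.toℚᵘ-fromℚᵘ (ℚᵘ.mkℚᵘ (+ 1) t)) ⟩
  toℚᵘ (+ 1 ℚ./ suc t)   ∎)
  where open ℚᵘₚ.≤-Reasoning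

archimedean : ∀ {ε} → 0ℚ ℚ.< ε → ∃[ t ] + 1 ℚ./ suc t ℚ.≤ ε
archimedean {ε@(ℚ.mkℚ (+ suc a) d _)} _ = d , ℚₚ.toℚᵘ-cancel-≤ (begin
  toℚᵘ (+ 1 ℚ./ suc d)      ≃⟨ ℚₚ.toℚᵘ-fromℚᵘ (ℚᵘ.mkℚᵘ (+ 1) d) ⟩
  ℚᵘ.mkℚᵘ (+ 1) d           ≤⟨ mkℚᵘ-≤ (ℕₚ.*-monoˡ-≤ (suc d) (ℕ.s≤s {0} {a} ℕ.z≤n)) ⟩
  ℚᵘ.mkℚᵘ (+ suc a) d       ∎)
  where open ℚᵘₚ.≤-Reasoning
archimedean {ℚ.mkℚ (+ zero) d _} (ℚ.*<* h) =
  contradiction (subst (ℤ.+0 ℤ.<_) refl h) (ℤₚ.<-irrefl refl)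
archimedean {ℚ.mkℚ ℤ.-[1+ _ ] d _} (ℚ.*<* ())

/1-homo-+ : ∀ m n → + m ℚ./ 1 ℚ.+ + n ℚ./ 1 ≡ + (m ℕ.+ n) ℚ./ 1
/1-homo-+ m n = ℚₚ.toℚᵘ-injective (begin
  toℚᵘ (+ m ℚ./ 1 ℚ.+ + n ℚ./ 1)
    ≈⟨ ℚₚ.toℚᵘ-homo-+ (+ m ℚ./ 1) (+ n ℚ./ 1) ⟩
  toℚᵘ (+ m ℚ./ 1) ℚᵘ.+ toℚᵘ (+ n ℚ./ 1)
    ≈⟨ ℚᵘₚ.+-cong (ℚₚ.toℚᵘ-fromℚᵘ (ℚᵘ.mkℚᵘ (+ m) 0)) (ℚₚ.toℚᵘ-fromℚᵘ (ℚᵘ.mkℚᵘ (+ n) 0)) ⟩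
  ℚᵘ.mkℚᵘ (+ m) 0 ℚᵘ.+ ℚᵘ.mkℚᵘ (+ n) 0
    ≡⟨ cong (λ i → ℚᵘ.mkℚᵘ i 0) (cong₂ ℤ._+_ (ℤₚ.*-identityʳ (+ m)) (ℤₚ.*-identityʳ (+ n))) ⟩
  ℚᵘ.mkℚᵘ (+ (m ℕ.+ n)) 0
    ≈⟨ ℚᵘₚ.≃-sym (ℚₚ.toℚᵘ-fromℚᵘ (ℚᵘ.mkℚᵘ (+ (m ℕ.+ n)) 0)) ⟩
  toℚᵘ (+ (m ℕ.+ n) ℚ./ 1) ∎)
  where open import Relation.Binary.Reasoning.Setoid ℚᵘₚ.≃-setoid

num : ℚ → ℕ
num q = ℤ.∣ ↥ q ∣

toℚᵘ-num : ∀ {q} → 0ℚ ℚ.≤ q → toℚᵘ q ≡ ℚᵘ.mkℚᵘ (+ num q) (ℚ.ℚ.denominator-1 q)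
toℚᵘ-num {ℚ.mkℚ (+ n) d c} _ = refl
toℚᵘ-num {ℚ.mkℚ ℤ.-[1+ n ] d c} (ℚ.*≤* ())

clear-denominators : ∀ A B {q q′} → 0ℚ ℚ.≤ q → 0ℚ ℚ.≤ q′ →
  + A ℚ./ 1 ℚ.* q ℚ.≤ + B ℚ./ 1 ℚ.* q′ →
  A ℕ.* (num q ℕ.* ↧ₙ q′) ℕ.≤ B ℕ.* (num q′ ℕ.* ↧ₙ q)
clear-denominators A B {q} {q′} 0≤q 0≤q′ h =
  subst₂ ℕ._≤_ (lemma A (num q) (↧ₙ q′)) (lemma B (num q′) (↧ₙ q))
    (drop-mkℚᵘ-≤ (begin
      ℚᵘ.mkℚᵘ (+ (A ℕ.* num q)) (d q ℕ.+ 0)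
        ≡⟨ sym (unfold A 0≤q) ⟩
      ℚᵘ.mkℚᵘ (+ A) 0 ℚᵘ.* toℚᵘ q
        ≃⟨ ℚᵘₚ.≃-sym (homo A q) ⟩
      toℚᵘ (+ A ℚ./ 1 ℚ.* q)
        ≤⟨ ℚₚ.toℚᵘ-mono-≤ h ⟩
      toℚᵘ (+ B ℚ./ 1 ℚ.* q′)
        ≃⟨ homo B q′ ⟩
      ℚᵘ.mkℚᵘ (+ B) 0 ℚᵘ.* toℚᵘ q′
        ≡⟨ unfold B 0≤q′ ⟩
      ℚᵘ.mkℚᵘ (+ (B ℕ.* num q′)) (d q′ ℕ.+ 0) ∎))
  where
  open ℚᵘₚ.≤-Reasoning
  d : ℚ → ℕ
  d = ℚ.ℚ.denominator-1
  homo : ∀ A q → toℚᵘ (+ A ℚ./ 1 ℚ.* q) ℚᵘ.≃ ℚᵘ.mkℚᵘ (+ A) 0 ℚᵘ.* toℚᵘ q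
  homo A q = ℚᵘₚ.≃-trans (ℚₚ.toℚᵘ-homo-* (+ A ℚ./ 1) q)
    (ℚᵘₚ.*-congʳ {toℚᵘ q} (ℚₚ.toℚᵘ-fromℚᵘ (ℚᵘ.mkℚᵘ (+ A) 0)))
  unfold : ∀ A {q} → 0ℚ ℚ.≤ q →
    ℚᵘ.mkℚᵘ (+ A) 0 ℚᵘ.* toℚᵘ q ≡ ℚᵘ.mkℚᵘ (+ (A ℕ.* num q)) (d q ℕ.+ 0)
  unfold A {q} 0≤q = trans (cong (ℚᵘ.mkℚᵘ (+ A) 0 ℚᵘ.*_) (toℚᵘ-num 0≤q))
    (cong (λ i → ℚᵘ.mkℚᵘ i (d q ℕ.+ 0)) (sym (ℤₚ.pos-* A (num q))))
  lemma : ∀ A n k → A ℕ.* n ℕ.* suc (ℕ.pred k ℕ.+ 0) ≡ A ℕ.* (n ℕ.* suc (ℕ.pred k))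
  lemma A n k = trans (cong (λ j → A ℕ.* n ℕ.* suc j) (ℕₚ.+-identityʳ (ℕ.pred k)))
    (ℕₚ.*-assoc A n (suc (ℕ.pred k)))

combine : ∀ {f g n m t} →
  f ℕ.* suc m ℕ.* suc t ℕ.≤ suc n ℕ.* suc m ℕ.+ (1 ℕ.+ g) ℕ.* suc n ℕ.* suc t →
  + f ℚ./ suc n ℚ.≤ + g ℚ./ suc m ℚ.+ + 1 ℚ./ suc m ℚ.+ + 1 ℚ./ suc t
combine {f} {g} {n} {m} {t} h = ℚₚ.toℚᵘ-cancel-≤ (begin
  toℚᵘ (+ f ℚ./ suc n)
    ≃⟨ ℚₚ.toℚᵘ-fromℚᵘ (ℚᵘ.mkℚᵘ (+ f) n) ⟩
  ℚᵘ.mkℚᵘ (+ f) n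
    ≤⟨ mkℚᵘ-≤ (subst₂ ℕ._≤_
         (solve 3 (λ f m t → m :* (f :* m :* t) := f :* (m :* m :* t)) refl f (suc m) (suc t))
         (solve 4 (λ g n m t → m :* (n :* m :+ (con 1 :+ g) :* n :* t) :=
                               ((g :* m :+ con 1 :* m) :* t :+ con 1 :* (m :* m)) :* n)
            refl g (suc n) (suc m) (suc t))
         (ℕₚ.*-monoʳ-≤ (suc m) h)) ⟩
  ℚᵘ.mkℚᵘ (+ ((g ℕ.* suc m ℕ.+ 1 ℕ.* suc m) ℕ.* suc t ℕ.+ 1 ℕ.* (suc m ℕ.* suc m)))
          (ℕ.pred (suc m ℕ.* suc m ℕ.* suc t))
    ≡⟨ cong (λ i → ℚᵘ.mkℚᵘ i _) num-eq ⟩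
  ℚᵘ.mkℚᵘ (+ g) m ℚᵘ.+ ℚᵘ.mkℚᵘ (+ 1) m ℚᵘ.+ ℚᵘ.mkℚᵘ (+ 1) t
    ≃⟨ ℚᵘₚ.≃-sym (ℚᵘₚ.≃-trans
         (ℚₚ.toℚᵘ-homo-+ (+ g ℚ./ suc m ℚ.+ + 1 ℚ./ suc m) (+ 1 ℚ./ suc t))
         (ℚᵘₚ.+-cong (ℚᵘₚ.≃-trans (ℚₚ.toℚᵘ-homo-+ (+ g ℚ./ suc m) (+ 1 ℚ./ suc m))
           (ℚᵘₚ.+-cong (ℚₚ.toℚᵘ-fromℚᵘ (ℚᵘ.mkℚᵘ (+ g) m)) (ℚₚ.toℚᵘ-fromℚᵘ (ℚᵘ.mkℚᵘ (+ 1) m))))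
           (ℚₚ.toℚᵘ-fromℚᵘ (ℚᵘ.mkℚᵘ (+ 1) t)))) ⟩
  toℚᵘ (+ g ℚ./ suc m ℚ.+ + 1 ℚ./ suc m ℚ.+ + 1 ℚ./ suc t) ∎)
  where
  open ℚᵘₚ.≤-Reasoning
  open ℕSolver.+-*-Solver
  num-eq : + ((g ℕ.* suc m ℕ.+ 1 ℕ.* suc m) ℕ.* suc t ℕ.+ 1 ℕ.* (suc m ℕ.* suc m)) ≡
    (+ g ℤ.* + suc m ℤ.+ + 1 ℤ.* + suc m) ℤ.* + suc t ℤ.+ + 1 ℤ.* + (suc m ℕ.* suc m)
  num-eq = cong₂ ℤ._+_
    (trans (ℤₚ.pos-* (g ℕ.* suc m ℕ.+ 1 ℕ.* suc m) (suc t))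
      (cong (ℤ._* + suc t) (cong₂ ℤ._+_ (ℤₚ.pos-* g (suc m)) (ℤₚ.pos-* 1 (suc m)))))
    (ℤₚ.pos-* 1 (suc m ℕ.* suc m))

-- ⌊ log₂ (qⁿ) ⌋, where q is replaced by 1 when q < 1
⌊log₂_^_⌋ : ℚ → ℕ → ℕ
⌊log₂ q ^ n ⌋ = ⌊log₂ (num q₁ ℕ.^ n ℕ./ ↧ₙ q₁ ℕ.^ n) ⌋
  where
  q₁ = q ℚ.⊔ 1ℚ
  instance _ = ℕₚ.m^n≢0 (↧ₙ q₁) n

log₂-approx : ℚ → ℕ → ℚ
log₂-approx q n = + ⌊log₂ q ^ suc n ⌋ ℚ./ suc n

log₂-approx-close : ∀ {q q′ δ t n m} →
  (+ (2 ℕ.* suc t) ℚ./ 1) ℚ.* δ ≡ 1ℚ → 0ℚ ℚ.≤ δ → q ℚ.≤ q′ ℚ.+ δ →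
  log₂-approx q n ℚ.≤ log₂-approx q′ m ℚ.+ + 1 ℚ./ suc m ℚ.+ + 1 ℚ./ suc t
log₂-approx-close {q} {q′} {δ} {t} {n} {m} aδ≡1 0≤δ h =
  combine {⌊log₂ q ^ suc n ⌋} {⌊log₂ q′ ^ suc m ⌋} {n} {m} {t}
    (NatLog.compare {num a} {↧ₙ a} {num b} {↧ₙ b}
      {⌊log₂ q ^ suc n ⌋} {1 ℕ.+ ⌊log₂ q′ ^ suc m ⌋} {suc n} {suc m}
      (ℕ.s≤s ℕ.z≤n)
      (NatLog.2^⌊log₂/⌋*r≤p (num a ℕ.^ suc n) (↧ₙ a ℕ.^ suc n) (ℕₚ.^-monoˡ-≤ (suc n) {↧ₙ a} {num a} a-den≤num))
      (NatLog.p≤2^1+⌊log₂/⌋*r (num b ℕ.^ suc m) (↧ₙ b ℕ.^ suc m))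
      (clear-denominators A (1 ℕ.+ A) {a} {b} (0≤⊔1 q) (0≤⊔1 q′) main))
  where
  a b : ℚ
  a = q ℚ.⊔ 1ℚ
  b = q′ ℚ.⊔ 1ℚ
  A : ℕ
  A = 2 ℕ.* suc t
  instance
    _ = ℕₚ.m^n≢0 (↧ₙ a) (suc n)
    _ = ℕₚ.m^n≢0 (↧ₙ b) (suc m)
  0≤⊔1 : ∀ q → 0ℚ ℚ.≤ q ℚ.⊔ 1ℚ
  0≤⊔1 q = ℚₚ.≤-trans (ℚₚ.<⇒≤ 0<1) (ℚₚ.p≤q⊔p q 1ℚ)
  a-den≤num : ↧ₙ a ℕ.≤ num a
  a-den≤num = subst₂ ℕ._≤_
    (ℕₚ.*-identityˡ (↧ₙ a)) (ℕₚ.*-identityʳ (num a))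
    (drop-mkℚᵘ-≤ {1} {0} {num a} {ℚ.ℚ.denominator-1 a}
      (subst (ℚᵘ.mkℚᵘ (+ 1) 0 ℚᵘ.≤_) (toℚᵘ-num (0≤⊔1 q))
        (ℚₚ.toℚᵘ-mono-≤ (ℚₚ.p≤q⊔p q 1ℚ))))
  a≤b+δ : a ℚ.≤ b ℚ.+ δ
  a≤b+δ = ℚₚ.⊔-lub
    (ℚₚ.≤-trans h (ℚₚ.+-monoˡ-≤ δ (ℚₚ.p≤p⊔q q′ 1ℚ)))
    (ℚₚ.≤-trans (ℚₚ.p≤q⊔p q′ 1ℚ)
      (subst (ℚ._≤ b ℚ.+ δ) (ℚₚ.+-identityʳ b) (ℚₚ.+-monoʳ-≤ b 0≤δ)))
  k : ℚ
  k = + A ℚ./ 1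
  main : k ℚ.* a ℚ.≤ + (1 ℕ.+ A) ℚ./ 1 ℚ.* b
  main = begin
    k ℚ.* a             ≤⟨ ℚₚ.*-monoˡ-≤-nonNeg k {{ℚₚ.normalize-nonNeg A 1}} a≤b+δ ⟩
    k ℚ.* (b ℚ.+ δ)     ≡⟨ ℚₚ.*-distribˡ-+ k b δ ⟩
    k ℚ.* b ℚ.+ k ℚ.* δ ≡⟨ cong (k ℚ.* b ℚ.+_) aδ≡1 ⟩
    k ℚ.* b ℚ.+ 1ℚ      ≤⟨ ℚₚ.+-monoʳ-≤ (k ℚ.* b) (ℚₚ.p≤q⊔p q′ 1ℚ) ⟩
    k ℚ.* b ℚ.+ b       ≡⟨ solve 2 (λ k b → k :* b :+ b := (con 1ℚ :+ k) :* b) refl k b ⟩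
    (1ℚ ℚ.+ k) ℚ.* b    ≡⟨ cong (ℚ._* b) (/1-homo-+ 1 A) ⟩
    + (1 ℕ.+ A) ℚ./ 1 ℚ.* b ∎
    where
    open ℚₚ.≤-Reasoning
    open ℚSolver.+-*-Solver

absorb : ∀ {u v a b ε} → u ℚ.≤ v ℚ.+ a ℚ.+ b → a ℚ.≤ ½ ℚ.* ε → b ℚ.≤ ½ ℚ.* ε → u ℚ.≤ v ℚ.+ ε
absorb {u} {v} {a} {b} {ε} h a≤ b≤ = begin
  u                               ≤⟨ h ⟩
  v ℚ.+ a ℚ.+ b                   ≤⟨ ℚₚ.+-mono-≤ (ℚₚ.+-monoʳ-≤ v a≤) b≤ ⟩
  v ℚ.+ ½ ℚ.* ε ℚ.+ ½ ℚ.* ε       ≡⟨ ℚₚ.+-assoc v (½ ℚ.* ε) (½ ℚ.* ε) ⟩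
  v ℚ.+ (½ ℚ.* ε ℚ.+ ½ ℚ.* ε)     ≡⟨ cong (v ℚ.+_) (half+half ε) ⟩
  v ℚ.+ ε                         ∎
  where open ℚₚ.≤-Reasoning

2t-positive : ∀ t → 0ℚ ℚ.< + (2 ℕ.* suc t) ℚ./ 1
2t-positive t = ℚₚ.positive⁻¹ (+ (2 ℕ.* suc t) ℚ./ 1) {{ℚₚ.normalize-pos (2 ℕ.* suc t) 1}}

abstract
  log₂-cauchy : ∀ x → Cauchy (λ n → log₂-approx (seq x n) n)
  log₂-cauchy x ε 0<ε = from-t (archimedean (half-pos 0<ε))
    where
    Goal : Set
    Goal = ∃[ N ] (∀ m n → N ℕ.≤ m → N ℕ.≤ n →
      log₂-approx (seq x m) m ℚ.≤ log₂-approx (seq x n) n ℚ.+ ε)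
    from-δ : ∀ t → + 1 ℚ./ suc t ℚ.≤ ½ ℚ.* ε →
      ∃[ δ ] (0ℚ ℚ.< δ × (+ (2 ℕ.* suc t) ℚ./ 1) ℚ.* δ ≡ 1ℚ) → Goal
    from-δ t 1/t≤ (δ , 0<δ , 2tδ≡1) = N ℕ.⊔ t , λ m n m≥ n≥ →
      absorb {log₂-approx (seq x m) m} {log₂-approx (seq x n) n} {+ 1 ℚ./ suc n} {+ 1 ℚ./ suc t} {ε}
        (log₂-approx-close {seq x m} {seq x n} {δ} {t} {m} {n} 2tδ≡1 (ℚₚ.<⇒≤ 0<δ)
          (proj₂ (cauchy x δ 0<δ) m n (⊔-≤ˡ m≥) (⊔-≤ˡ n≥)))
        (ℚₚ.≤-trans (1/-antitone {t} {n} (ℕ.s≤s (⊔-≤ʳ {N} n≥))) 1/t≤)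
        1/t≤
      where
      N : ℕ
      N = proj₁ (cauchy x δ 0<δ)
    from-t : ∃[ t ] + 1 ℚ./ suc t ℚ.≤ ½ ℚ.* ε → Goal
    from-t (t , 1/t≤) = from-δ t 1/t≤ (scale (2t-positive t) 0<1)

-- Truncated: this is log₂ (max x 1).
log₂ : ℝ → ℝ
log₂ x = mkℝ (λ n → log₂-approx (seq x n) n) (log₂-cauchy x)

ℝ^_ : ℕ → Set
ℝ^ d = Vector ℝ d

infix 4 _≋_ _≤ᵛ_

_≋_ _≤ᵛ_ : ∀ {d} → ℝ^ d → ℝ^ d → Set
x ≋ y  = ∀ i → x i ≃ y i
x ≤ᵛ y = ∀ i → x i ≤ y i

0ᵛ : ∀ {d} → ℝ^ d
0ᵛ _ = 0ℝ

sum : ∀ {n} → ℝ^ n → ℝ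
sum = foldr _+_ 0ℝ

infixl 7 _·_

_·_ : ∀ {d} → ℝ^ d → ℝ^ d → ℝ
x · y = sum (zipWith _*_ x y)

-- The order on ℝ is not decidable, so comparisons are replaced by ⊔ and ⊓.
insert : ∀ {d} → ℝ → ℝ^ d → ℝ^ (suc d)
insert {zero}  a x = a ∷ []
insert {suc d} a x = a ⊔ head x ∷ insert (a ⊓ head x) (tail x)

sort↓ : ∀ {d} → ℝ^ d → ℝ^ d
sort↓ {zero}  x = x
sort↓ {suc d} x = insert (head x) (sort↓ (tail x))

∣_∣↓ : ∀ {d} → ℝ^ d → ℝ^ d
∣ x ∣↓ = sort↓ (map ∣_∣ x)

record IsWeight {d} (w : ℝ^ d) : Set where
  field
    decreasing : ∀ {i j} → i Data.Fin.≤ j → w j ≤ w i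
    nonneg     : 0ᵛ ≤ᵛ w
    nonzero    : ¬ (w ≋ 0ᵛ)

orderedNorm : ∀ {d} → ℝ^ d → ℝ^ d → ℝ
orderedNorm w x = w · ∣ x ∣↓

IsOrderedNorm : ∀ d → Pred (ℝ^ d → ℝ) 0ℓ
IsOrderedNorm d f = ∃[ w ] (IsWeight w × (∀ x → f x ≃ orderedNorm w x))

record IsNorm {d} (f : ℝ^ d → ℝ) : Set where
  field
    congruent   : ∀ {x y} → x ≋ y → f x ≃ f y
    triangle    : ∀ x y → f (zipWith _+_ x y) ≤ f x + f y
    homogeneous : ∀ a x → f (map (a *_) x) ≃ ∣ a ∣ * f x
    definite    : ∀ {x} → f x ≃ 0ℝ → x ≋ 0ᵛ

record IsSymmetricMonotonicNorm d (f : ℝ^ d → ℝ) : Set where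
  field
    isNorm    : IsNorm f
    symmetric : ∀ (π : Permutation′ d) x → f (λ i → x (π ⟨$⟩ʳ i)) ≃ f x
    monotonic : ∀ {x y} → 0ᵛ ≤ᵛ x → x ≤ᵛ y → f x ≤ f y

ConvexHull : ∀ {d n} → Vector (ℝ^ d) n → Pred (ℝ^ d) 0ℓ
ConvexHull v x = ∃[ μ ]
  (0ᵛ ≤ᵛ μ × sum μ ≃ 1ℝ × (∀ i → x i ≃ μ · (λ j → v j i)))

IsPolytope : ∀ {d} → Pred (ℝ^ d) 0ℓ → Set
IsPolytope {d} 𝒟 = ∃₂ λ n (v : Vector (ℝ^ d) n) → ∀ x → x ∈ 𝒟 ⇔ x ∈ ConvexHull v

-- min_X f ≤ α min_𝒟 f says that for no y ∈ 𝒟 do all x ∈ X have f x > α (f y).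
-- The double negation is there because a minimum over a finite set of reals
-- need not be attained at a constructively identifiable element.
record IsPortfolio {d} (α : ℝ) (𝐂 : Pred (ℝ^ d → ℝ) 0ℓ) (𝒟 X : Pred (ℝ^ d) 0ℓ) : Set where
  field
    1≤α    : 1ℝ ≤ α
    subset : X ⊆ 𝒟
    approx : ∀ {f} → f ∈ 𝐂 → ∀ {y} → y ∈ 𝒟 → ¬ ¬ (∃[ x ] (x ∈ X × f x ≤ α * f y))

HasSizeAtMost : ∀ {d} → Pred (ℝ^ d) 0ℓ → ℕ → Set
HasSizeAtMost {d} X N = ∃ λ (e : Vector (ℝ^ d) N) → ∀ {x} → x ∈ X → ∃[ j ] x ≋ e j

-- d ^ (c / log log d) ≤ N, after taking logarithms and multiplying by log log d.
-- The base of the logarithms only affects the constant c.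
SizeBound : ℝ → ℕ → ℕ → Set
SizeBound c d N = c * log₂ (fromℕ d) ≤ log₂ (fromℕ N) * log₂ (log₂ (fromℕ d))

-- The polytopes 𝒟 k ⊆ ℝ^(dim k) run over a sequence of dimensions.
PortfolioLowerBound : (∀ d → Pred (ℝ^ d → ℝ) 0ℓ) →
                      (dim : ℕ → ℕ) → (∀ k → Pred (ℝ^ (dim k)) 0ℓ) → Set₁
PortfolioLowerBound 𝐂 dim 𝒟 =
  ∀ K → 0ℝ < K →
  ∃[ c ] (0ℝ < c × ∃[ d₀ ] (∀ k → d₀ ℕ.≤ dim k →
    ∀ X → IsPortfolio (K * log₂ (fromℕ (dim k))) (𝐂 (dim k)) (𝒟 k) X →
    ∀ N → HasSizeAtMost X N → SizeBound c (dim k) N))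

TendsToInfinity : (ℕ → ℕ) → Set
TendsToInfinity a = ∀ M → ∃[ k₀ ] (∀ k → k₀ ℕ.≤ k → M ℕ.≤ a k)

{-# OPTIONS --safe #-}

-- The polytope is the hull of 2 ^ m vertices that are all decreasing, so there every ordered norm is
-- the linear functional given by its weight. Coordinates are grouped into blocks whose sizes grow by a
-- factor R², and the j-th vertex is Rᵗ⁺ᵇ on the t-th block from the end, where b is the t-th bit of a
-- code of j. The j-th weight uses the complementary bits: its product with the j-th vertex is of order R
-- on every block (after normalising by the dimension), while any other vertex has a block of order R²,
-- because codes are pairwise incomparable. If one point of the hull served two norms i ≠ i′, then, by
-- linearity and since every vertex is bad for i or for i′, R would be O(α log d). With R about
-- (log d)⁵ this fails, so distinct norms need distinct members of the portfolio, and
-- 2 ^ m = d ^ Ω(1 / log log d). For the second class, ordered norms are symmetric monotonic: the value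
-- w · sort↓ x is the maximum of w · y over the rearrangements y of x.

module Submission where

-- Block profiles and their products over the natural numbers.

module Profiles where
  open import Data.Bool using (Bool; true; false; not)
  open import Data.Nat using (ℕ; zero; suc; _+_; _*_; _^_; _∸_; _≤_; _<_; _<?_; z≤n; s≤s; s≤s⁻¹)
  open import Data.Nat.Properties
  open import Data.Nat.Solver using (module +-*-Solver)
  open import Data.Vec using (Vec; []; _∷_; map)
  open import Function using (_∘_)
  open import Relation.Binary.PropositionalEquality
  open import Relation.Nullary using (¬_; Dec; yes; no; contradiction)

  Σ< : ℕ → (ℕ → ℕ) → ℕ
  Σ< zero    f = 0
  Σ< (suc n) f = f 0 + Σ< n (f ∘ suc)

  Σ<-+ : ∀ m n f → Σ< (m + n) f ≡ Σ< m f + Σ< n (λ x → f (m + x))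
  Σ<-+ zero    n f = refl
  Σ<-+ (suc m) n f = trans (cong (f 0 +_) (Σ<-+ m n (f ∘ suc))) (sym (+-assoc (f 0) _ _))

  Σ<-cong : ∀ n {f g} → (∀ x → x < n → f x ≡ g x) → Σ< n f ≡ Σ< n g
  Σ<-cong zero    h = refl
  Σ<-cong (suc n) h = cong₂ _+_ (h 0 (s≤s z≤n)) (Σ<-cong n λ x x<n → h (suc x) (s≤s x<n))

  Σ<-const : ∀ n c → Σ< n (λ _ → c) ≡ n * c
  Σ<-const zero    c = refl
  Σ<-const (suc n) c = cong (c +_) (Σ<-const n c)

  *-distribˡ-Σ< : ∀ n c f → Σ< n (λ x → c * f x) ≡ c * Σ< n f
  *-distribˡ-Σ< zero    c f = sym (*-zeroʳ c)
  *-distribˡ-Σ< (suc n) c f = trans (cong (c * f 0 +_) (*-distribˡ-Σ< n c (f ∘ suc)))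
    (sym (*-distribˡ-+ c (f 0) (Σ< n (f ∘ suc))))

  module Profile (R : ℕ) (1<R : 1 < R) where

    -- The length of a vector for `S` bits: one initial coordinate, then `S` blocks, each `ρ` times
    -- as long as everything before it. The growth factor `R * R` offsets the factor `R` that each
    -- of two profiles loses per block, so the blocks of a product get comparable weight.
    size : ℕ → ℕ
    size S = (R * R) ^ S

    ρ : ℕ
    ρ = R * R ∸ 1

    R*R≡1+ρ : R * R ≡ 1 + ρ
    R*R≡1+ρ = sym (m+[n∸m]≡n (*-mono-≤ (<⇒≤ 1<R) (<⇒≤ 1<R)))

    1≤ρ : 1 ≤ ρ
    1≤ρ = s≤s⁻¹ (subst (2 ≤_) R*R≡1+ρ (≤-trans 1<R (subst (_≤ R * R) (*-identityʳ R) (*-monoʳ-≤ R (<⇒≤ 1<R)))))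

    size-suc : ∀ S → size (suc S) ≡ size S + ρ * size S
    size-suc S = cong (_* size S) R*R≡1+ρ

    digit : Bool → ℕ
    digit true  = R
    digit false = 1

    1≤digit : ∀ b → 1 ≤ digit b
    1≤digit true  = <⇒≤ 1<R
    1≤digit false = ≤-refl

    digit≤R : ∀ b → digit b ≤ R
    digit≤R true  = ≤-refl
    digit≤R false = <⇒≤ 1<R

    select : ∀ {P : Set} → Dec P → ℕ → ℕ → ℕ
    select (yes _) a b = a
    select (no _)  a b = b

    -- On block t = 0, 1, … counted from the last (and longest) one, the value is Rᵗ⁺ᵇ with b the bit t.
    profile : ∀ {S} → Vec Bool S → ℕ → ℕ
    profile []               x = 1
    profile {suc S} (b ∷ bs) x = select (x <? size S) (R * profile bs x) (digit b)

    select-yes : ∀ {P : Set} (p? : Dec P) {a b} → P → select p? a b ≡ a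
    select-yes (yes _) _ = refl
    select-yes (no ¬p) p = contradiction p ¬p

    select-no : ∀ {P : Set} (p? : Dec P) {a b} → ¬ P → select p? a b ≡ b
    select-no (yes p) ¬p = contradiction p ¬p
    select-no (no _)  _  = refl

    1≤profile : ∀ {S} (bs : Vec Bool S) x → 1 ≤ profile bs x
    1≤profile []               x = ≤-refl
    1≤profile {suc S} (b ∷ bs) x with x <? size S
    ... | yes _ = *-mono-≤ (<⇒≤ 1<R) (1≤profile bs x)
    ... | no  _ = 1≤digit b

    -- An inner block carries an extra factor `R`, so its values are at least `R` and dominate the
    -- digit of the next block, whatever the bits are.
    profile-antitone : ∀ {S} (bs : Vec Bool S) {x y} → x ≤ y → profile bs y ≤ profile bs x
    profile-antitone []               x≤y = ≤-refl
    profile-antitone {suc S} (b ∷ bs) {x} {y} x≤y with x <? size S | y <? size S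
    ... | yes _   | yes _   = *-monoʳ-≤ R (profile-antitone bs x≤y)
    ... | yes _   | no  _   = ≤-trans (digit≤R b)
      (subst (_≤ R * profile bs x) (*-identityʳ R) (*-monoʳ-≤ R (1≤profile bs x)))
    ... | no  x≮B | yes y<B = contradiction (≤-<-trans x≤y y<B) x≮B
    ... | no  _   | no  _   = ≤-refl

    dot : ∀ {S} → Vec Bool S → Vec Bool S → ℕ
    dot {S} as bs = Σ< (size S) λ x → profile as x * profile bs x

    -- Both profiles gain a factor `R` on the first `size S` coordinates and are constant on the
    -- block that `a` and `b` add.
    dot-∷ : ∀ {S} a b (as bs : Vec Bool S) →
      dot (a ∷ as) (b ∷ bs) ≡ R * R * dot as bs + ρ * size S * (digit a * digit b)
    dot-∷ {S} a b as bs = begin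
      Σ< (size (suc S)) f
        ≡⟨ cong (λ n → Σ< n f) (size-suc S) ⟩
      Σ< (size S + ρ * size S) f
        ≡⟨ Σ<-+ (size S) (ρ * size S) f ⟩
      Σ< (size S) f + Σ< (ρ * size S) (λ x → f (size S + x))
        ≡⟨ cong₂ _+_ inner outer ⟩
      R * R * dot as bs + ρ * size S * (digit a * digit b) ∎
      where
      open ≡-Reasoning
      f : ℕ → ℕ
      f x = profile (a ∷ as) x * profile (b ∷ bs) x
      inner : Σ< (size S) f ≡ R * R * dot as bs
      inner = trans
        (Σ<-cong (size S) λ x x<B → trans
          (cong₂ _*_ (select-yes (x <? size S) x<B) (select-yes (x <? size S) x<B))
          (solve 3 (λ r p q → r :* p :* (r :* q) := r :* r :* (p :* q)) refl R (profile as x) (profile bs x)))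
        (*-distribˡ-Σ< (size S) (R * R) (λ x → profile as x * profile bs x))
        where open +-*-Solver
      outer : Σ< (ρ * size S) (λ x → f (size S + x)) ≡ ρ * size S * (digit a * digit b)
      outer = trans
        (Σ<-cong (ρ * size S) λ x _ → cong₂ _*_
          (select-no (size S + x <? size S) (m+n≮m (size S) x))
          (select-no (size S + x <? size S) (m+n≮m (size S) x)))
        (Σ<-const (ρ * size S) (digit a * digit b))

    digit*digit-not : ∀ b → digit (not b) * digit b ≡ R
    digit*digit-not true  = *-identityˡ R
    digit*digit-not false = *-identityʳ R

    -- Complementary digits multiply to `R`, so the initial coordinate and each of the `S` blocks
    -- contribute at most `R * size S`.
    dot-not-≤ : ∀ {S} (bs : Vec Bool S) → dot (map not bs) bs ≤ suc S * R * size S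
    dot-not-≤ [] = subst (1 ≤_) (trans (sym (*-identityˡ R)) (sym (*-identityʳ (1 * R)))) (<⇒≤ 1<R)
    dot-not-≤ {suc S} (b ∷ bs) = begin
      dot (not b ∷ map not bs) (b ∷ bs)
        ≡⟨ dot-∷ (not b) b (map not bs) bs ⟩
      R * R * dot (map not bs) bs + ρ * size S * (digit (not b) * digit b)
        ≡⟨ cong (λ r → R * R * dot (map not bs) bs + ρ * size S * r) (digit*digit-not b) ⟩
      R * R * dot (map not bs) bs + ρ * size S * R
        ≤⟨ +-mono-≤ (*-monoʳ-≤ (R * R) (dot-not-≤ bs))
             (*-monoˡ-≤ R (*-monoˡ-≤ (size S) (subst (ρ ≤_) (sym R*R≡1+ρ) (n≤1+n ρ)))) ⟩
      R * R * (suc S * R * size S) + R * R * size S * R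
        ≡⟨ solve 3 (λ r s b → r :* r :* ((con 1 :+ s) :* r :* b) :+ r :* r :* b :* r :=
             (con 2 :+ s) :* r :* (r :* r :* b)) refl R S (size S) ⟩
      suc (suc S) * R * size (suc S) ∎
      where
      open ≤-Reasoning
      open +-*-Solver

    -- Two bits `true` give `R * R` on every coordinate of the outermost block, and that block is at
    -- least half of the vector because `1 ≤ ρ`. The factor 2 accounts for this half.
    dot-∷-≥-head : ∀ {S} (as bs : Vec Bool S) →
      R * R * size (suc S) ≤ 2 * dot (true ∷ as) (true ∷ bs)
    dot-∷-≥-head {S} as bs = begin
      R * R * (R * R * size S)
        ≡⟨ cong (λ r → R * R * (r * size S)) R*R≡1+ρ ⟩
      R * R * ((1 + ρ) * size S)
        ≤⟨ *-monoʳ-≤ (R * R) (*-monoˡ-≤ (size S) (+-monoˡ-≤ ρ 1≤ρ)) ⟩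
      R * R * ((ρ + ρ) * size S)
        ≡⟨ solve 3 (λ r p b → r :* r :* ((p :+ p) :* b) := con 2 :* (p :* b :* (r :* r))) refl R ρ (size S) ⟩
      2 * (ρ * size S * (R * R))
        ≤⟨ *-monoʳ-≤ 2 (m≤n+m (ρ * size S * (R * R)) (R * R * dot as bs)) ⟩
      2 * (R * R * dot as bs + ρ * size S * (R * R))
        ≡⟨ cong (2 *_) (sym (dot-∷ true true as bs)) ⟩
      2 * dot (true ∷ as) (true ∷ bs) ∎
      where
      open ≤-Reasoning
      open +-*-Solver

    -- A large product stays large when an outer block is put on: the old product and the length are
    -- both multiplied by `R * R`, and the new block only adds.
    dot-∷-≥-tail : ∀ {S} a b (as bs : Vec Bool S) → R * R * size S ≤ 2 * dot as bs →
      R * R * size (suc S) ≤ 2 * dot (a ∷ as) (b ∷ bs)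
    dot-∷-≥-tail {S} a b as bs h = begin
      R * R * (R * R * size S)
        ≤⟨ *-monoʳ-≤ (R * R) h ⟩
      R * R * (2 * dot as bs)
        ≡⟨ solve 2 (λ r d → r :* r :* (con 2 :* d) := con 2 :* (r :* r :* d)) refl R (dot as bs) ⟩
      2 * (R * R * dot as bs)
        ≤⟨ *-monoʳ-≤ 2 (m≤m+n (R * R * dot as bs) (ρ * size S * (digit a * digit b))) ⟩
      2 * (R * R * dot as bs + ρ * size S * (digit a * digit b))
        ≡⟨ cong (2 *_) (sym (dot-∷ a b as bs)) ⟩
      2 * dot (a ∷ as) (b ∷ bs) ∎
      where
      open ≤-Reasoning
      open +-*-Solver

    -- Doubling each bit to b, ¬ b makes distinct codes incomparable.
    code : ∀ {m} → Vec Bool m → Vec Bool (m * 2)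
    code []       = []
    code (b ∷ bs) = b ∷ not b ∷ code bs

    -- Where `as` and `bs` differ, one bit of the doubled pair is false in `code as` and true in
    -- `code bs`; complementing the first gives a block with both bits `true`. Equal leading bits
    -- are skipped by two uses of `dot-∷-≥-tail`.
    dot-code-≥ : ∀ {m} (as bs : Vec Bool m) → as ≢ bs →
      R * R * size (m * 2) ≤ 2 * dot (map not (code as)) (code bs)
    dot-code-≥ []           []           as≢bs = contradiction refl as≢bs
    dot-code-≥ (false ∷ as) (true  ∷ bs) _     =
      dot-∷-≥-head (false ∷ map not (code as)) (false ∷ code bs)
    -- Here it is the second bit of the doubled pair that separates.
    dot-code-≥ (true  ∷ as) (false ∷ bs) _     =
      dot-∷-≥-tail false false (true ∷ map not (code as)) (true ∷ code bs)
        (dot-∷-≥-head (map not (code as)) (code bs))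
    dot-code-≥ (true  ∷ as) (true  ∷ bs) as≢bs =
      dot-∷-≥-tail false true (true ∷ map not (code as)) (false ∷ code bs)
        (dot-∷-≥-tail true false (map not (code as)) (code bs) (dot-code-≥ as bs (as≢bs ∘ cong (true ∷_))))
    dot-code-≥ (false ∷ as) (false ∷ bs) as≢bs =
      dot-∷-≥-tail true false (false ∷ map not (code as)) (true ∷ code bs)
        (dot-∷-≥-tail false true (map not (code as)) (code bs) (dot-code-≥ as bs (as≢bs ∘ cong (false ∷_))))

open Profiles

open import Defs
open import Algebra.Bundles using (CommutativeSemiring)
open import Data.Bool using (Bool; not)
open import Data.Empty using (⊥)
open import Data.Fin as Fin using (Fin; zero; suc; punchIn; toℕ; remQuot)
open import Data.Fin.Permutation as Perm using (Permutation′; _⟨$⟩ʳ_; _⟨$⟩ˡ_; _∘ₚ_)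
open import Data.Fin.Properties as Finₚ using ()
open import Data.Integer using (+_)
open import Data.Nat as ℕ using (ℕ; zero; suc)
open import Data.Nat.DivMod using (m*n/n≡m; /-monoˡ-≤)
open import Data.Nat.Logarithm using (⌊log₂_⌋; ⌊log₂⌋-mono-≤; ⌊log₂[2^n]⌋≡n)
open import Data.Nat.Properties as ℕₚ using ()
open import Data.Product using (Σ-syntax; ∃-syntax; _×_; _,_; proj₁; proj₂)
open import Data.Rational as ℚ using (ℚ; 0ℚ; 1ℚ; ½; ↧ₙ_; toℚᵘ)
open import Data.Rational.Properties as ℚₚ using ()
open import Data.Sum using (_⊎_; inj₁; inj₂)
open import Data.Vec as Vec using (Vec)
open import Data.Vec.Functional using (Vector; []; _∷_; head; tail; map; removeAt; zipWith)
open import Data.Vec.Properties as Vecₚ using ()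
open import Effect.Monad using (RawMonad)
open import Function using (_∘_)
open import Function.Bundles using (Inverse; Injection)
open import Function.Construct.Identity using (⇔-id)
open import Function.Properties.Inverse using (↔⇒↣)
open import Level using (0ℓ)
open import Relation.Binary.Bundles using (Poset)
open import Relation.Binary.PropositionalEquality
open import Relation.Nullary using (¬_; yes; no; contradiction)
open import Relation.Nullary.Negation using (¬¬-Monad)
open import Relation.Unary using (Pred; _∈_; _⊆_)
import Algebra.Properties.Semiring.Sum as SemiringSum
import Data.Nat.Solver as ℕSolver
import Data.Rational.Solver as ℚSolver
import Data.Rational.Unnormalised as ℚᵘ
import Data.Rational.Unnormalised.Properties as ℚᵘₚ
import Relation.Binary.Reasoning.PartialOrder as PosetReasoning

-- Order, lattice operations and semiring structure of the reals.

infix 4 _≲_ _≈_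

-- Opaque copies of the order and the equality: _≤_ unfolds to its definition,
-- which would hide the compared reals from unification.
record _≲_ (x y : ℝ) : Set where
  constructor wrap
  field unwrap : x ≤ y
open _≲_ public

record _≈_ (x y : ℝ) : Set where
  constructor _⇄_
  field
    fwd : x ≲ y
    bwd : y ≲ x
open _≈_ public

≃⇒≈ : ∀ {x y} → x ≃ y → x ≈ y
≃⇒≈ (p , q) = wrap p ⇄ wrap q

≈⇒≃ : ∀ {x y} → x ≈ y → x ≃ y
≈⇒≃ (p ⇄ q) = unwrap p , unwrap q

≤-pointwise : ∀ {x y} → (∀ n → seq x n ℚ.≤ seq y n) → x ≲ y
≤-pointwise {x} {y} h = wrap λ ε 0<ε → 0 , λ n _ → ℚₚ.≤-trans (h n)
  (subst (ℚ._≤ seq y n ℚ.+ ε) (ℚₚ.+-identityʳ (seq y n)) (ℚₚ.+-monoʳ-≤ (seq y n) (ℚₚ.<⇒≤ 0<ε)))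

≈-pointwise : ∀ {x y} → (∀ n → seq x n ≡ seq y n) → x ≈ y
≈-pointwise h = ≤-pointwise (λ n → ℚₚ.≤-reflexive (h n)) ⇄
                ≤-pointwise (λ n → ℚₚ.≤-reflexive (sym (h n)))

≈-refl : ∀ {x} → x ≈ x
≈-refl = ≈-pointwise λ _ → refl

≈-sym : ∀ {x y} → x ≈ y → y ≈ x
≈-sym (p ⇄ q) = q ⇄ p

≤-trans : ∀ {x y z} → x ≲ y → y ≲ z → x ≲ z
≤-trans {x} {y} {z} (wrap p) (wrap q) = wrap λ ε 0<ε →
  let (M , p′) = p (½ ℚ.* ε) (half-pos 0<ε)
      (N , q′) = q (½ ℚ.* ε) (half-pos 0<ε)
  in M ℕ.⊔ N , λ n n≥ → begin
    seq x n                               ≤⟨ p′ n (⊔-≤ˡ n≥) ⟩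
    seq y n ℚ.+ ½ ℚ.* ε                   ≤⟨ ℚₚ.+-monoˡ-≤ (½ ℚ.* ε) (q′ n (⊔-≤ʳ {M} n≥)) ⟩
    seq z n ℚ.+ ½ ℚ.* ε ℚ.+ ½ ℚ.* ε       ≡⟨ ℚₚ.+-assoc (seq z n) _ _ ⟩
    seq z n ℚ.+ (½ ℚ.* ε ℚ.+ ½ ℚ.* ε)     ≡⟨ cong (seq z n ℚ.+_) (half+half ε) ⟩
    seq z n ℚ.+ ε                         ∎
  where open ℚₚ.≤-Reasoning

≤-poset : Poset 0ℓ 0ℓ 0ℓ
≤-poset = record
  { Carrier = ℝ ; _≈_ = _≈_ ; _≤_ = _≲_
  ; isPartialOrder = record
    { isPreorder = record
      { isEquivalence = record
        { refl  = ≈-refl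
        ; sym   = ≈-sym
        ; trans = λ (p ⇄ q) (p′ ⇄ q′) → ≤-trans p p′ ⇄ ≤-trans q′ q }
      ; reflexive = fwd
      ; trans     = ≤-trans }
    ; antisym = _⇄_ } }

module ≤-Reasoning = PosetReasoning ≤-poset

open Poset ≤-poset public using () renaming (refl to ≤-refl)
open Poset.Eq ≤-poset public using () renaming (trans to ≈-trans)

+-mono-≤ : ∀ {x y u v} → x ≲ y → u ≲ v → x + u ≲ y + v
+-mono-≤ {x} {y} {u} {v} (wrap p) (wrap q) = wrap λ ε 0<ε →
  let (M , p′) = p (½ ℚ.* ε) (half-pos 0<ε)
      (N , q′) = q (½ ℚ.* ε) (half-pos 0<ε)
  in M ℕ.⊔ N , λ n n≥ → begin
    seq x n ℚ.+ seq u n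
      ≤⟨ ℚₚ.+-mono-≤ (p′ n (⊔-≤ˡ n≥)) (q′ n (⊔-≤ʳ {M} n≥)) ⟩
    (seq y n ℚ.+ ½ ℚ.* ε) ℚ.+ (seq v n ℚ.+ ½ ℚ.* ε)
      ≡⟨ solve 3 (λ a b e → (a :+ e) :+ (b :+ e) := (a :+ b) :+ (e :+ e)) refl
           (seq y n) (seq v n) (½ ℚ.* ε) ⟩
    (seq y n ℚ.+ seq v n) ℚ.+ (½ ℚ.* ε ℚ.+ ½ ℚ.* ε)
      ≡⟨ cong (seq y n ℚ.+ seq v n ℚ.+_) (half+half ε) ⟩
    (seq y n ℚ.+ seq v n) ℚ.+ ε ∎
  where
  open ℚₚ.≤-Reasoning
  open ℚSolver.+-*-Solver

⊔-lub : ∀ {x y z} → x ≲ z → y ≲ z → x ⊔ y ≲ z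
⊔-lub (wrap p) (wrap q) = wrap λ ε 0<ε →
  let (M , p′) = p ε 0<ε
      (N , q′) = q ε 0<ε
  in M ℕ.⊔ N , λ n n≥ → ℚₚ.⊔-lub (p′ n (⊔-≤ˡ n≥)) (q′ n (⊔-≤ʳ {M} n≥))

⊓-glb : ∀ {x y z} → z ≲ x → z ≲ y → z ≲ x ⊓ y
⊓-glb {x} {y} {z} (wrap p) (wrap q) = wrap λ ε 0<ε →
  let (M , p′) = p ε 0<ε
      (N , q′) = q ε 0<ε
  in M ℕ.⊔ N , λ n n≥ → subst (seq z n ℚ.≤_)
    (sym (ℚₚ.mono-≤-distrib-⊓ (ℚₚ.+-monoˡ-≤ ε) (seq x n) (seq y n)))
    (ℚₚ.⊓-glb (p′ n (⊔-≤ˡ n≥)) (q′ n (⊔-≤ʳ {M} n≥)))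

x≤x⊔y : ∀ {x y} → x ≲ x ⊔ y
x≤x⊔y {x} {y} = ≤-pointwise λ n → ℚₚ.p≤p⊔q (seq x n) (seq y n)

y≤x⊔y : ∀ {x y} → y ≲ x ⊔ y
y≤x⊔y {x} {y} = ≤-pointwise λ n → ℚₚ.p≤q⊔p (seq x n) (seq y n)

x⊓y≤x : ∀ {x y} → x ⊓ y ≲ x
x⊓y≤x {x} {y} = ≤-pointwise λ n → ℚₚ.p⊓q≤p (seq x n) (seq y n)

x⊓y≤y : ∀ {x y} → x ⊓ y ≲ y
x⊓y≤y {x} {y} = ≤-pointwise λ n → ℚₚ.p⊓q≤q (seq x n) (seq y n)

x≥y⇒x⊔y≈x : ∀ {x y} → y ≲ x → x ⊔ y ≈ x
x≥y⇒x⊔y≈x p = ⊔-lub ≤-refl p ⇄ x≤x⊔y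

x≤y⇒x⊔y≈y : ∀ {x y} → x ≲ y → x ⊔ y ≈ y
x≤y⇒x⊔y≈y p = ⊔-lub p ≤-refl ⇄ y≤x⊔y

x≤y⇒x⊓y≈x : ∀ {x y} → x ≲ y → x ⊓ y ≈ x
x≤y⇒x⊓y≈x p = x⊓y≤x ⇄ ⊓-glb ≤-refl p

x≥y⇒x⊓y≈y : ∀ {x y} → y ≲ x → x ⊓ y ≈ y
x≥y⇒x⊓y≈y p = x⊓y≤y ⇄ ⊓-glb p ≤-refl

⊔-cong : ∀ {x y u v} → x ≈ y → u ≈ v → x ⊔ u ≈ y ⊔ v
⊔-cong (p ⇄ p′) (q ⇄ q′) =
  ⊔-lub (≤-trans p x≤x⊔y) (≤-trans q y≤x⊔y) ⇄ ⊔-lub (≤-trans p′ x≤x⊔y) (≤-trans q′ y≤x⊔y)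

neg-antimono : ∀ {x y} → x ≲ y → - y ≲ - x
neg-antimono {x} {y} (wrap p) = wrap λ ε 0<ε → let (N , p′) = p ε 0<ε in N , λ n n≥ → begin
  ℚ.- seq y n                     ≡⟨ solve 2 (λ a e → :- a := :- (a :+ e) :+ e) refl (seq y n) ε ⟩
  ℚ.- (seq y n ℚ.+ ε) ℚ.+ ε       ≤⟨ ℚₚ.+-monoˡ-≤ ε (ℚₚ.neg-antimono-≤ (p′ n n≥)) ⟩
  ℚ.- seq x n ℚ.+ ε               ∎
  where
  open ℚₚ.≤-Reasoning
  open ℚSolver.+-*-Solver

private
  -- The sign of `z` is unknown, so the estimate uses a bound on the absolute value of `z` times the
  -- distance of `x` and `y`, which takes both halves of `x ≈ y`.
  *-congʳ-≤ : ∀ {x y} z → x ≈ y → z * x ≲ z * y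
  *-congʳ-≤ {x} {y} z (wrap p ⇄ wrap q) = wrap λ ε 0<ε →
    let (B , K , 0<B , b) = bounded z
        (δ , 0<δ , eq)    = scale 0<B 0<ε
        (M , p′)          = p δ 0<δ
        (N , q′)          = q δ 0<δ
    in K ℕ.⊔ (M ℕ.⊔ N) , λ n n≥ →
    let c = seq z n; a = seq x n; a′ = seq y n
        n≥′ = ⊔-≤ʳ {K} n≥
    in begin
      c ℚ.* a
        ≡⟨ solve 3 (λ c a a′ → c :* a := c :* a′ :+ c :* (a :- a′)) refl c a a′ ⟩
      c ℚ.* a′ ℚ.+ c ℚ.* (a ℚ.- a′)
        ≤⟨ ℚₚ.+-monoʳ-≤ (c ℚ.* a′) (product-bound {c} {a ℚ.- a′} (ℚₚ.<⇒≤ 0<δ) (b n (⊔-≤ˡ n≥))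
             (close (p′ n (⊔-≤ˡ n≥′)) (q′ n (⊔-≤ʳ {M} n≥′)))) ⟩
      c ℚ.* a′ ℚ.+ B ℚ.* δ
        ≡⟨ cong (c ℚ.* a′ ℚ.+_) eq ⟩
      c ℚ.* a′ ℚ.+ ε ∎
    where
    open ℚₚ.≤-Reasoning
    open ℚSolver.+-*-Solver

*-congʳ : ∀ {x y} z → x ≈ y → z * x ≈ z * y
*-congʳ z p = *-congʳ-≤ z p ⇄ *-congʳ-≤ z (≈-sym p)

*-comm : ∀ x y → x * y ≈ y * x
*-comm x y = ≈-pointwise λ n → ℚₚ.*-comm (seq x n) (seq y n)

*-cong : ∀ {x y u v} → x ≈ y → u ≈ v → x * u ≈ y * v
*-cong {x} {y} {u} {v} p q = ≈-trans (*-congʳ x q)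
  (≈-trans (*-comm x v) (≈-trans (*-congʳ v p) (*-comm v y)))

-- `0ℝ ≲ z` still lets single terms of `seq z` be negative. Passing to `z ⊔ 0ℝ`, an equal real with
-- nonnegative terms, allows a termwise estimate.
*-monoʳ-≤ : ∀ {x y} z → 0ℝ ≲ z → x ≲ y → z * x ≲ z * y
*-monoʳ-≤ {x} {y} z 0≤z p@(wrap p″) = begin
  z * x          ≈⟨ *-cong z≈z⁺ ≈-refl ⟩
  (z ⊔ 0ℝ) * x   ≤⟨ main ⟩
  (z ⊔ 0ℝ) * y   ≈⟨ *-cong z≈z⁺ ≈-refl ⟨
  z * y          ∎
  where
  open ≤-Reasoning
  z≈z⁺ : z ≈ z ⊔ 0ℝ
  z≈z⁺ = ≈-sym (x≥y⇒x⊔y≈x 0≤z)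
  main : (z ⊔ 0ℝ) * x ≲ (z ⊔ 0ℝ) * y
  main = wrap λ ε 0<ε →
    let (B , K , 0<B , b) = bounded (z ⊔ 0ℝ)
        (δ , 0<δ , eq)    = scale 0<B 0<ε
        (M , p′)          = p″ δ 0<δ
    in K ℕ.⊔ M , λ n n≥ →
    let c = seq z n ℚ.⊔ 0ℚ
        0≤c = ℚₚ.p≤q⊔p (seq z n) 0ℚ
    in ℚₚ.≤-trans
      (ℚₚ.*-monoˡ-≤-nonNeg c {{ℚ.nonNegative 0≤c}} (p′ n (⊔-≤ʳ {K} n≥)))
      (ℚₚ.≤-trans (ℚₚ.≤-reflexive (ℚₚ.*-distribˡ-+ c (seq y n) δ))
        (ℚₚ.+-monoʳ-≤ (c ℚ.* seq y n) (ℚₚ.≤-trans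
          (ℚₚ.*-monoʳ-≤-nonNeg δ {{ℚ.nonNegative (ℚₚ.<⇒≤ 0<δ)}}
            (ℚₚ.≤-trans (≤-abs c) (b n (⊔-≤ˡ n≥))))
          (ℚₚ.≤-reflexive eq))))

*-monoˡ-≤ : ∀ {x y} z → 0ℝ ≲ z → x ≲ y → x * z ≲ y * z
*-monoˡ-≤ {x} {y} z 0≤z p = begin
  x * z ≈⟨ *-comm x z ⟩
  z * x ≤⟨ *-monoʳ-≤ z 0≤z p ⟩
  z * y ≈⟨ *-comm z y ⟩
  y * z ∎
  where open ≤-Reasoning

ℝ-commutativeSemiring : CommutativeSemiring 0ℓ 0ℓ
ℝ-commutativeSemiring = record
  { Carrier = ℝ ; _≈_ = _≈_ ; _+_ = _+_ ; _*_ = _*_ ; 0# = 0ℝ ; 1# = 1ℝ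
  ; isCommutativeSemiring = record
    { isSemiring = record
      { isSemiringWithoutAnnihilatingZero = record
        { +-isCommutativeMonoid = record
          { isMonoid = record
            { isSemigroup = record
              { isMagma = record
                { isEquivalence = Poset.Eq.isEquivalence ≤-poset
                ; ∙-cong = λ (p ⇄ p′) (q ⇄ q′) → +-mono-≤ p q ⇄ +-mono-≤ p′ q′ }
              ; assoc = λ x y z → ≈-pointwise λ n → ℚₚ.+-assoc (seq x n) (seq y n) (seq z n) }
            ; identity = (λ x → ≈-pointwise λ n → ℚₚ.+-identityˡ (seq x n)) ,
                         (λ x → ≈-pointwise λ n → ℚₚ.+-identityʳ (seq x n)) }
          ; comm = λ x y → ≈-pointwise λ n → ℚₚ.+-comm (seq x n) (seq y n) }
        ; *-cong = *-cong
        ; *-assoc = λ x y z → ≈-pointwise λ n → ℚₚ.*-assoc (seq x n) (seq y n) (seq z n)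
        ; *-identity = (λ x → ≈-pointwise λ n → ℚₚ.*-identityˡ (seq x n)) ,
                       (λ x → ≈-pointwise λ n → ℚₚ.*-identityʳ (seq x n))
        ; distrib = (λ x y z → ≈-pointwise λ n → ℚₚ.*-distribˡ-+ (seq x n) (seq y n) (seq z n)) ,
                    (λ x y z → ≈-pointwise λ n → ℚₚ.*-distribʳ-+ (seq x n) (seq y n) (seq z n)) }
      ; zero = (λ x → ≈-pointwise λ n → ℚₚ.*-zeroˡ (seq x n)) ,
               (λ x → ≈-pointwise λ n → ℚₚ.*-zeroʳ (seq x n)) }
    ; *-comm = *-comm } }

-- Strict order, and comparison up to double negation.

private
  ℚ-+-cancelˡ-≤ : ∀ p {q r} → p ℚ.+ q ℚ.≤ p ℚ.+ r → q ℚ.≤ r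
  ℚ-+-cancelˡ-≤ p {q} {r} h = begin
    q                     ≡⟨ solve 2 (λ p q → q := :- p :+ (p :+ q)) refl p q ⟩
    ℚ.- p ℚ.+ (p ℚ.+ q)   ≤⟨ ℚₚ.+-monoʳ-≤ (ℚ.- p) h ⟩
    ℚ.- p ℚ.+ (p ℚ.+ r)   ≡⟨ solve 2 (λ p r → :- p :+ (p :+ r) := r) refl p r ⟩
    r                     ∎
    where
    open ℚₚ.≤-Reasoning
    open ℚSolver.+-*-Solver

<⇒≤ : ∀ {x y} → x < y → x ≲ y
<⇒≤ {x} {y} (γ , 0<γ , N , h) = wrap λ ε 0<ε → N , λ n n≥ → begin
  seq x n            ≡⟨ ℚₚ.+-identityʳ (seq x n) ⟨
  seq x n ℚ.+ 0ℚ     ≤⟨ ℚₚ.+-monoʳ-≤ (seq x n) (ℚₚ.<⇒≤ 0<γ) ⟩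
  seq x n ℚ.+ γ      ≤⟨ h n n≥ ⟩
  seq y n            ≡⟨ ℚₚ.+-identityʳ (seq y n) ⟨
  seq y n ℚ.+ 0ℚ     ≤⟨ ℚₚ.+-monoʳ-≤ (seq y n) (ℚₚ.<⇒≤ 0<ε) ⟩
  seq y n ℚ.+ ε      ∎
  where open ℚₚ.≤-Reasoning

<⇒≱ : ∀ {x y} → x < y → ¬ y ≲ x
<⇒≱ {x} {y} (γ , 0<γ , M , h) (wrap q) =
  let (N , q′) = q (½ ℚ.* γ) (half-pos 0<γ)
      n = M ℕ.⊔ N
  in ℚₚ.<-irrefl refl (ℚₚ.<-≤-trans (half-pos 0<γ) (ℚ-+-cancelˡ-≤ (seq x n ℚ.+ ½ ℚ.* γ) (begin
    seq x n ℚ.+ ½ ℚ.* γ ℚ.+ ½ ℚ.* γ     ≡⟨ ℚₚ.+-assoc (seq x n) _ _ ⟩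
    seq x n ℚ.+ (½ ℚ.* γ ℚ.+ ½ ℚ.* γ)   ≡⟨ cong (seq x n ℚ.+_) (half+half γ) ⟩
    seq x n ℚ.+ γ                       ≤⟨ h n (ℕₚ.m≤m⊔n M N) ⟩
    seq y n                             ≤⟨ q′ n (ℕₚ.m≤n⊔m M N) ⟩
    seq x n ℚ.+ ½ ℚ.* γ                 ≡⟨ ℚₚ.+-identityʳ _ ⟨
    seq x n ℚ.+ ½ ℚ.* γ ℚ.+ 0ℚ          ∎)))
  where open ℚₚ.≤-Reasoning

-- The order is undecidable, but to a given precision one late pair of rational terms settles it.
-- The pair is compared with tolerance half of `ε`, and each Cauchy modulus costs an eighth of `ε`,
-- so either outcome keeps a quarter of `ε` to spare.
≤ε⊎> : ∀ x y {ε} → 0ℚ ℚ.< ε → (∃[ N ] ∀ n → N ℕ.≤ n → seq x n ℚ.≤ seq y n ℚ.+ ε) ⊎ y < x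
≤ε⊎> x y {ε} 0<ε
  with cauchy x (½ ℚ.* (½ ℚ.* (½ ℚ.* ε))) (half-pos (half-pos (half-pos 0<ε)))
     | cauchy y (½ ℚ.* (½ ℚ.* (½ ℚ.* ε))) (half-pos (half-pos (half-pos 0<ε)))
... | M , p | N , q with seq x (M ℕ.⊔ N) ℚₚ.≤? seq y (M ℕ.⊔ N) ℚ.+ ½ ℚ.* ε
... | yes r = inj₁ (M ℕ.⊔ N , λ n n≥ → begin
    seq x n
      ≤⟨ p n _ (⊔-≤ˡ n≥) (ℕₚ.m≤m⊔n M N) ⟩
    seq x (M ℕ.⊔ N) ℚ.+ η
      ≤⟨ ℚₚ.+-monoˡ-≤ η r ⟩
    seq y (M ℕ.⊔ N) ℚ.+ h ℚ.+ η
      ≤⟨ ℚₚ.+-monoˡ-≤ η (ℚₚ.+-monoˡ-≤ h (q _ n (ℕₚ.m≤n⊔m M N) (⊔-≤ʳ {M} n≥))) ⟩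
    seq y n ℚ.+ η ℚ.+ h ℚ.+ η
      ≡⟨ solve 3 (λ y η h → y :+ η :+ h :+ η := y :+ h :+ (η :+ η)) refl (seq y n) η h ⟩
    seq y n ℚ.+ h ℚ.+ (η ℚ.+ η)
      ≡⟨ cong (seq y n ℚ.+ h ℚ.+_) (half+half (½ ℚ.* h)) ⟩
    seq y n ℚ.+ h ℚ.+ ½ ℚ.* h
      ≡⟨ ℚₚ.+-identityʳ _ ⟨
    seq y n ℚ.+ h ℚ.+ ½ ℚ.* h ℚ.+ 0ℚ
      ≤⟨ ℚₚ.+-monoʳ-≤ (seq y n ℚ.+ h ℚ.+ ½ ℚ.* h) (ℚₚ.<⇒≤ (half-pos (half-pos 0<ε))) ⟩
    seq y n ℚ.+ h ℚ.+ ½ ℚ.* h ℚ.+ ½ ℚ.* h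
      ≡⟨ solve 2 (λ y e → y :+ con ½ :* e :+ con ½ :* (con ½ :* e) :+ con ½ :* (con ½ :* e) := y :+ e)
           refl (seq y n) ε ⟩
    seq y n ℚ.+ ε ∎)
  where
  open ℚₚ.≤-Reasoning
  open ℚSolver.+-*-Solver
  h η : ℚ
  h = ½ ℚ.* ε
  η = ½ ℚ.* (½ ℚ.* h)
... | no r = inj₂ (½ ℚ.* h , half-pos (half-pos 0<ε) , M ℕ.⊔ N , λ n n≥ → ℚ-+-cancelˡ-≤ η (begin
    η ℚ.+ (seq y n ℚ.+ ½ ℚ.* h)
      ≤⟨ ℚₚ.+-monoʳ-≤ η (ℚₚ.+-monoˡ-≤ (½ ℚ.* h) (q n _ (⊔-≤ʳ {M} n≥) (ℕₚ.m≤n⊔m M N))) ⟩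
    η ℚ.+ (seq y (M ℕ.⊔ N) ℚ.+ η ℚ.+ ½ ℚ.* h)
      ≡⟨ solve 2 (λ y h → con ½ :* (con ½ :* h) :+ (y :+ con ½ :* (con ½ :* h) :+ con ½ :* h) := y :+ h)
           refl (seq y (M ℕ.⊔ N)) h ⟩
    seq y (M ℕ.⊔ N) ℚ.+ h
      ≤⟨ ℚₚ.<⇒≤ (ℚₚ.≰⇒> r) ⟩
    seq x (M ℕ.⊔ N)
      ≤⟨ p _ n (ℕₚ.m≤m⊔n M N) (⊔-≤ˡ n≥) ⟩
    seq x n ℚ.+ η
      ≡⟨ ℚₚ.+-comm (seq x n) η ⟩
    η ℚ.+ seq x n ∎))
  where
  open ℚₚ.≤-Reasoning
  open ℚSolver.+-*-Solver
  h η : ℚ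
  h = ½ ℚ.* ε
  η = ½ ℚ.* (½ ℚ.* h)

-- The second outcome of `≤ε⊎>` refutes `x ≲ y`, so it cannot occur. Proofs of inequalities may
-- therefore argue inside a double negation, by cases on `≤-total` or with a sorting permutation.
≤-stable : ∀ {x y} → ¬ ¬ x ≲ y → x ≲ y
≤-stable {x} {y} h = wrap λ ε 0<ε → case (≤ε⊎> x y 0<ε)
  where
  case : ∀ {P : Set} → P ⊎ y < x → P
  case (inj₁ p)   = p
  case (inj₂ y<x) = contradiction (<⇒≱ {y} {x} y<x) h

≰⇒> : ∀ {x y} → ¬ x ≲ y → ¬ ¬ y < x
≰⇒> {x} {y} h k = h (wrap λ ε 0<ε → case (≤ε⊎> x y 0<ε))
  where
  case : ∀ {P : Set} → P ⊎ y < x → P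
  case (inj₁ p)   = p
  case (inj₂ y<x) = contradiction y<x k

≤-total : ∀ x y → ¬ ¬ (x ≲ y ⊎ y ≲ x)
≤-total x y h = ≰⇒> {x} {y} (λ p → h (inj₁ p)) (λ p → h (inj₂ (<⇒≤ {y} {x} p)))

open CommutativeSemiring ℝ-commutativeSemiring
  using (+-cong; +-congˡ; +-assoc; +-identityˡ; +-identityʳ; *-identityˡ; *-identityʳ; zeroˡ; zeroʳ; distribˡ)
open SemiringSum (CommutativeSemiring.semiring ℝ-commutativeSemiring)
  using (sum-cong-≋; sum-remove; ∑-distrib-+; ∑-comm; *-distribˡ-sum; *-distribʳ-sum)

-- Ordered norms are symmetric monotonic norms.

module OrderedNorms where
  open ≤-Reasoning

  ∣-∣-nonneg : ∀ x → 0ℝ ≲ ∣ x ∣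
  ∣-∣-nonneg x = ≤-pointwise λ n → 0≤⊔- (seq x n)
    where
    0≤⊔- : ∀ p → 0ℚ ℚ.≤ p ℚ.⊔ ℚ.- p
    0≤⊔- p with ℚₚ.≤-total 0ℚ p
    ... | inj₁ 0≤p = ℚₚ.≤-trans 0≤p (ℚₚ.p≤p⊔q p (ℚ.- p))
    ... | inj₂ p≤0 = ℚₚ.≤-trans (ℚₚ.neg-antimono-≤ p≤0) (ℚₚ.p≤q⊔p p (ℚ.- p))

  x≤∣x∣ : ∀ {x} → x ≲ ∣ x ∣
  x≤∣x∣ = x≤x⊔y

  -x≤∣x∣ : ∀ {x} → - x ≲ ∣ x ∣
  -x≤∣x∣ = y≤x⊔y

  ∣-∣-cong : ∀ {x y} → x ≈ y → ∣ x ∣ ≈ ∣ y ∣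
  ∣-∣-cong (p ⇄ q) = ⊔-cong (p ⇄ q) (neg-antimono q ⇄ neg-antimono p)

  0≤x⇒-x≤0 : ∀ {x} → 0ℝ ≲ x → - x ≲ 0ℝ
  0≤x⇒-x≤0 {x} 0≤x = begin
    - x   ≤⟨ neg-antimono 0≤x ⟩
    - 0ℝ  ≈⟨ ≈-pointwise (λ _ → refl) ⟩
    0ℝ    ∎

  0≤x⇒∣x∣≈x : ∀ {x} → 0ℝ ≲ x → ∣ x ∣ ≈ x
  0≤x⇒∣x∣≈x 0≤x = x≥y⇒x⊔y≈x (≤-trans (0≤x⇒-x≤0 0≤x) 0≤x)

  ∣x∣≤0⇒x≈0 : ∀ {x} → ∣ x ∣ ≲ 0ℝ → x ≈ 0ℝ
  ∣x∣≤0⇒x≈0 {x} p = ≤-trans x≤∣x∣ p ⇄ (begin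
    0ℝ        ≈⟨ ≈-pointwise (λ _ → refl) ⟩
    - 0ℝ      ≤⟨ neg-antimono (≤-trans -x≤∣x∣ p) ⟩
    - - x     ≈⟨ ≈-pointwise (λ n → solve 1 (λ a → :- (:- a) := a) refl (seq x n)) ⟩
    x         ∎)
    where open ℚSolver.+-*-Solver

  ∣-∣-triangle : ∀ x y → ∣ x + y ∣ ≲ ∣ x ∣ + ∣ y ∣
  ∣-∣-triangle x y = ⊔-lub (+-mono-≤ x≤∣x∣ x≤∣x∣) (begin
    - (x + y)     ≈⟨ ≈-pointwise (λ n → ℚₚ.neg-distrib-+ (seq x n) (seq y n)) ⟩
    - x + - y     ≤⟨ +-mono-≤ -x≤∣x∣ -x≤∣x∣ ⟩
    ∣ x ∣ + ∣ y ∣ ∎)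

  ∣-∣-homo-* : ∀ x y → ∣ x * y ∣ ≈ ∣ x ∣ * ∣ y ∣
  ∣-∣-homo-* x y = ≈-pointwise λ n →
    trans (⊔-≡ (seq x n ℚ.* seq y n))
      (trans (ℚₚ.∣p*q∣≡∣p∣*∣q∣ (seq x n) (seq y n))
        (sym (cong₂ ℚ._*_ (⊔-≡ (seq x n)) (⊔-≡ (seq y n)))))
    where
    ⊔-≡ : ∀ p → p ℚ.⊔ ℚ.- p ≡ ℚ.∣ p ∣
    ⊔-≡ p = ℚₚ.≤-antisym
      (ℚₚ.⊔-lub (≤-abs p) (subst (ℚ.- p ℚ.≤_) (ℚₚ.∣-p∣≡∣p∣ p) (≤-abs (ℚ.- p))))
      (abs-≤ (ℚₚ.p≤p⊔q p (ℚ.- p)) (ℚₚ.p≤q⊔p p (ℚ.- p)))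

  Decreasing : ∀ {d} → ℝ^ d → Set
  Decreasing x = ∀ {i j} → i Fin.≤ j → x j ≲ x i

  Nonneg : ∀ {d} → ℝ^ d → Set
  Nonneg x = ∀ i → 0ℝ ≲ x i

  infix 4 _≈ᵛ_
  _≈ᵛ_ : ∀ {d} → ℝ^ d → ℝ^ d → Set
  x ≈ᵛ y = ∀ i → x i ≈ y i

  infixl 20 _⟪_⟫
  _⟪_⟫ : ∀ {d} → ℝ^ d → Permutation′ d → ℝ^ d
  (x ⟪ σ ⟫) i = x (σ ⟨$⟩ʳ i)

  sum-mono : ∀ {d} {x y : ℝ^ d} → (∀ i → x i ≲ y i) → sum x ≲ sum y
  sum-mono {zero}  h = ≤-refl
  sum-mono {suc d} h = +-mono-≤ (h zero) (sum-mono (h ∘ suc))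

  sum-nonneg : ∀ {d} {x : ℝ^ d} → Nonneg x → 0ℝ ≲ sum x
  sum-nonneg {zero}  h = ≤-refl
  sum-nonneg {suc d} {x} h = begin
    0ℝ              ≈⟨ +-identityˡ 0ℝ ⟨
    0ℝ + 0ℝ         ≤⟨ +-mono-≤ (h zero) (sum-nonneg (h ∘ suc)) ⟩
    sum x           ∎

  *-nonneg : ∀ {x y} → 0ℝ ≲ x → 0ℝ ≲ y → 0ℝ ≲ x * y
  *-nonneg {x} {y} p q = begin
    0ℝ       ≈⟨ zeroʳ x ⟨
    x * 0ℝ   ≤⟨ *-monoʳ-≤ x p q ⟩
    x * y    ∎

  ·-monoʳ : ∀ {d} {w x y : ℝ^ d} → Nonneg w → (∀ i → x i ≲ y i) → w · x ≲ w · y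
  ·-monoʳ {w = w} 0≤w h = sum-mono λ i → *-monoʳ-≤ (w i) (0≤w i) (h i)

  ·-congʳ : ∀ {d} (w : ℝ^ d) {x y : ℝ^ d} → x ≈ᵛ y → w · x ≈ w · y
  ·-congʳ w h = sum-cong-≋ λ i → *-congʳ (w i) (h i)

  -- When `b ≲ a`, the left side equals `v * (a + b) + (u + - v) * b`, which grows when the last `b`
  -- becomes `a`; when `a ≲ b`, both sides agree.
  rearrange₂ : ∀ {u v} a b → v ≲ u → u * b + v * a ≲ u * (a ⊔ b) + v * (a ⊓ b)
  rearrange₂ {u} {v} a b v≤u = ≤-stable λ k → ≤-total a b λ
    { (inj₁ a≤b) → k (begin
        u * b + v * a              ≈⟨ +-cong (*-congʳ u (x≤y⇒x⊔y≈y a≤b)) (*-congʳ v (x≤y⇒x⊓y≈x a≤b)) ⟨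
        u * (a ⊔ b) + v * (a ⊓ b)  ∎)
    ; (inj₂ b≤a) → k (begin
        u * b + v * a              ≈⟨ split ⟩
        v * (a + b) + (u + - v) * b ≤⟨ +-mono-≤ ≤-refl (*-monoʳ-≤ (u + - v) 0≤u-v b≤a) ⟩
        v * (a + b) + (u + - v) * a ≈⟨ merge ⟩
        u * a + v * b              ≈⟨ +-cong (*-congʳ u (x≥y⇒x⊔y≈x b≤a)) (*-congʳ v (x≥y⇒x⊓y≈y b≤a)) ⟨
        u * (a ⊔ b) + v * (a ⊓ b)  ∎) }
    where
    open ℚSolver.+-*-Solver
    0≤u-v : 0ℝ ≲ u + - v
    0≤u-v = begin
      0ℝ       ≈⟨ ≈-pointwise (λ n → ℚₚ.+-inverseʳ (seq v n)) ⟨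
      v + - v  ≤⟨ +-mono-≤ v≤u ≤-refl ⟩
      u + - v  ∎
    split : u * b + v * a ≈ v * (a + b) + (u + - v) * b
    split = ≈-pointwise λ n → solve 4
      (λ u v a b → u :* b :+ v :* a := v :* (a :+ b) :+ (u :- v) :* b) refl
      (seq u n) (seq v n) (seq a n) (seq b n)
    merge : v * (a + b) + (u + - v) * a ≈ u * a + v * b
    merge = ≈-pointwise λ n → solve 4
      (λ u v a b → v :* (a :+ b) :+ (u :- v) :* a := u :* a :+ v :* b) refl
      (seq u n) (seq v n) (seq a n) (seq b n)

  -- `insert` pushes `a` down the vector and leaves the larger entry behind at each comparison. Each
  -- comparison is one use of `rearrange₂`, so from any starting position `k` of `a` the product
  -- with decreasing weights never drops.
  ·-insert-≥ : ∀ {d} {w : ℝ^ (suc d)} a (x : ℝ^ d) k → Decreasing w →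
    w k * a + removeAt w k · x ≲ w · insert a x
  ·-insert-≥ {zero}  a x zero w↓ = ≤-refl
  ·-insert-≥ {suc d} {w} a x zero w↓ = begin
    w₀ * a + (w₁ * x₀ + w₂ · tail x)                    ≈⟨ +-assoc (w₀ * a) (w₁ * x₀) (w₂ · tail x) ⟨
    w₀ * a + w₁ * x₀ + w₂ · tail x                      ≤⟨ +-mono-≤ step ≤-refl ⟩
    w₀ * (a ⊔ x₀) + w₁ * (a ⊓ x₀) + w₂ · tail x         ≈⟨ +-assoc (w₀ * (a ⊔ x₀)) (w₁ * (a ⊓ x₀)) (w₂ · tail x) ⟩
    w₀ * (a ⊔ x₀) + (w₁ * (a ⊓ x₀) + w₂ · tail x)       ≤⟨ +-mono-≤ ≤-refl
      (·-insert-≥ (a ⊓ x₀) (tail x) zero (λ i≤j → w↓ (ℕ.s≤s i≤j))) ⟩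
    w · insert a x                                      ∎
    where
    w₀ w₁ x₀ : ℝ
    w₀ = w zero
    w₁ = w (suc zero)
    x₀ = head x
    w₂ : ℝ^ d
    w₂ = tail (tail w)
    step : w₀ * a + w₁ * x₀ ≲ w₀ * (a ⊔ x₀) + w₁ * (a ⊓ x₀)
    step = begin
      w₀ * a + w₁ * x₀                ≤⟨ rearrange₂ x₀ a (w↓ ℕ.z≤n) ⟩
      w₀ * (x₀ ⊔ a) + w₁ * (x₀ ⊓ a)   ≈⟨ ≈-pointwise (λ n → cong₂ (λ p q → seq w₀ n ℚ.* p ℚ.+ seq w₁ n ℚ.* q)
                                           (ℚₚ.⊔-comm (seq x₀ n) (seq a n)) (ℚₚ.⊓-comm (seq x₀ n) (seq a n))) ⟩
      w₀ * (a ⊔ x₀) + w₁ * (a ⊓ x₀)   ∎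
  ·-insert-≥ {suc d} {w} a x (suc k) w↓ = begin
    wₖ * a + (w₀ * x₀ + w′ · tail x)               ≈⟨ swap ⟩
    w₀ * x₀ + wₖ * a + w′ · tail x                 ≤⟨ +-mono-≤ (rearrange₂ a x₀ (w↓ ℕ.z≤n)) ≤-refl ⟩
    w₀ * (a ⊔ x₀) + wₖ * (a ⊓ x₀) + w′ · tail x    ≈⟨ +-assoc (w₀ * (a ⊔ x₀)) (wₖ * (a ⊓ x₀)) (w′ · tail x) ⟩
    w₀ * (a ⊔ x₀) + (wₖ * (a ⊓ x₀) + w′ · tail x)  ≤⟨ +-mono-≤ ≤-refl
      (·-insert-≥ (a ⊓ x₀) (tail x) k (λ i≤j → w↓ (ℕ.s≤s i≤j))) ⟩
    w · insert a x                                 ∎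
    where
    w₀ wₖ x₀ : ℝ
    w₀ = w zero
    wₖ = w (suc k)
    x₀ = head x
    w′ : ℝ^ d
    w′ = removeAt (tail w) k
    swap : wₖ * a + (w₀ * x₀ + w′ · tail x) ≈ w₀ * x₀ + wₖ * a + w′ · tail x
    swap = ≈-pointwise λ n → solve 3 (λ p q r → p :+ (q :+ r) := q :+ p :+ r) refl
      (seq (wₖ * a) n) (seq (w₀ * x₀) n) (seq (w′ · tail x) n)
      where open ℚSolver.+-*-Solver

  ·-cong-≡ : ∀ {d} (w : ℝ^ d) {x y : ℝ^ d} → (∀ i → x i ≡ y i) → w · x ≈ w · y
  ·-cong-≡ w h = ·-congʳ w λ i → subst (_ ≈_) (h i) ≈-refl

  -- Let `k` be the position where the head of `x` lands. The other positions carry a rearrangement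
  -- of the tail, bounded by induction, and `·-insert-≥` then moves the head from `k` to its sorted
  -- place.
  rearrangement : ∀ {d} {w : ℝ^ d} x (σ : Permutation′ d) → Decreasing w →
    w · x ⟪ σ ⟫ ≲ w · sort↓ x
  rearrangement {zero}  x σ w↓ = ≤-refl
  rearrangement {suc d} {w} x σ w↓ = begin
    w · x ⟪ σ ⟫
      ≈⟨ sum-remove {i = k} (zipWith _*_ w (x ⟪ σ ⟫)) ⟩
    w k * x (σ ⟨$⟩ʳ k) + removeAt w k · removeAt (x ⟪ σ ⟫) k
      ≈⟨ +-cong (subst (λ i → w k * x (σ ⟨$⟩ʳ k) ≈ w k * x i) (Perm.inverseʳ σ) ≈-refl)
           (·-cong-≡ (removeAt w k) λ i → cong x (Perm.punchIn-permute′ σ zero i)) ⟩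
    w k * head x + removeAt w k · tail x ⟪ Perm.remove k σ ⟫
      ≤⟨ +-mono-≤ ≤-refl (rearrangement (tail x) (Perm.remove k σ) (λ i≤j → w↓ (punchIn-mono k i≤j))) ⟩
    w k * head x + removeAt w k · sort↓ (tail x)
      ≤⟨ ·-insert-≥ (head x) (sort↓ (tail x)) k w↓ ⟩
    w · sort↓ x ∎
    where
    k : Fin (suc d)
    k = σ ⟨$⟩ˡ zero
    punchIn-mono : ∀ {n} (k : Fin (suc n)) {i j} → i Fin.≤ j → punchIn k i Fin.≤ punchIn k j
    punchIn-mono zero    i≤j = ℕ.s≤s i≤j
    punchIn-mono (suc k) {zero}  {j}     i≤j = ℕ.z≤n
    punchIn-mono (suc k) {suc i} {suc j} (ℕ.s≤s i≤j) = ℕ.s≤s (punchIn-mono k i≤j)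

  -- Which of `a` and `head x` comes first is undecidable, hence the double negation. If `a` is the
  -- smaller, a transposition of the first two positions accounts for the exchange.
  insert-permutes : ∀ {d} a (x : ℝ^ d) → ¬ ¬ (∃[ σ ] insert a x ≈ᵛ (a ∷ x) ⟪ σ ⟫)
  insert-permutes {zero}  a x h = h (Perm.id , λ { zero → ≈-refl })
  insert-permutes {suc d} a x h = ≤-total a (head x) λ
    { (inj₁ a≤x₀) → insert-permutes (a ⊓ head x) (tail x) λ (σ , p) →
        h (Perm.lift₀ σ ∘ₚ Perm.transpose zero (suc zero) , λ
          { zero    → x≤y⇒x⊔y≈y a≤x₀
          ; (suc i) → ≈-trans (p i) (swapped a≤x₀ (σ ⟨$⟩ʳ i)) })
    ; (inj₂ x₀≤a) → insert-permutes (a ⊓ head x) (tail x) λ (σ , p) →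
        h (Perm.lift₀ σ , λ
          { zero    → x≥y⇒x⊔y≈x x₀≤a
          ; (suc i) → ≈-trans (p i) (fixed x₀≤a (σ ⟨$⟩ʳ i)) }) }
    where
    swapped : a ≲ head x → ∀ j →
      ((a ⊓ head x) ∷ tail x) j ≈ (a ∷ x) (Perm.transpose zero (suc zero) ⟨$⟩ʳ suc j)
    swapped a≤x₀ zero    = x≤y⇒x⊓y≈x a≤x₀
    swapped a≤x₀ (suc j) = ≈-refl
    fixed : head x ≲ a → ∀ j → ((a ⊓ head x) ∷ tail x) j ≈ x j
    fixed x₀≤a zero    = x≥y⇒x⊓y≈y x₀≤a
    fixed x₀≤a (suc j) = ≈-refl

  sort↓-permutes : ∀ {d} (x : ℝ^ d) → ¬ ¬ (∃[ σ ] sort↓ x ≈ᵛ x ⟪ σ ⟫)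
  sort↓-permutes {zero}  x h = h (Perm.id , λ ())
  sort↓-permutes {suc d} x h =
    sort↓-permutes (tail x) λ (τ , q) →
    insert-permutes (head x) (sort↓ (tail x)) λ (σ , p) →
    h (σ ∘ₚ Perm.lift₀ τ , λ i → ≈-trans (p i) (sorted τ q (σ ⟨$⟩ʳ i)))
    where
    sorted : ∀ τ → sort↓ (tail x) ≈ᵛ tail x ⟪ τ ⟫ →
      ∀ j → (head x ∷ sort↓ (tail x)) j ≈ x (Perm.lift₀ τ ⟨$⟩ʳ j)
    sorted τ q zero    = ≈-refl
    sorted τ q (suc j) = q j

  -- Every bound on w · sort↓ x may be checked on the rearrangements of x.
  ·-sort↓-lub : ∀ {d} (w : ℝ^ d) x {b} → (∀ σ → w · x ⟪ σ ⟫ ≲ b) → w · sort↓ x ≲ b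
  ·-sort↓-lub w x h = ≤-stable λ k → sort↓-permutes x λ (σ , p) →
    k (≤-trans (fwd (·-congʳ w p)) (h σ))

  -- The sorted vectors are not compared directly: a rearrangement of `x` lies below the same
  -- rearrangement of `y`, whose product with `w` is at most the sorted one.
  ·-sort↓-mono : ∀ {d} {w x y : ℝ^ d} → Decreasing w → Nonneg w → (∀ i → x i ≲ y i) →
    w · sort↓ x ≲ w · sort↓ y
  ·-sort↓-mono {w = w} {x} {y} w↓ 0≤w x≤y = ·-sort↓-lub w x λ σ →
    ≤-trans (·-monoʳ 0≤w λ i → x≤y (σ ⟨$⟩ʳ i)) (rearrangement y σ w↓)

  insert-cons : ∀ {d} {a} {x : ℝ^ d} → (∀ i → x i ≲ a) → Decreasing x → insert a x ≈ᵛ a ∷ x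
  insert-cons {zero}  x≤a x↓ zero = ≈-refl
  insert-cons {suc d} x≤a x↓ zero = x≥y⇒x⊔y≈x (x≤a zero)
  insert-cons {suc d} {a} {x} x≤a x↓ (suc i) = ≈-trans
    (insert-cons {x = tail x} (λ j → ⊓-glb (x≤a (suc j)) (x↓ ℕ.z≤n)) (λ i≤j → x↓ (ℕ.s≤s i≤j)) i)
    (case i)
    where
    case : ∀ i → ((a ⊓ head x) ∷ tail x) i ≈ x i
    case zero    = x≥y⇒x⊓y≈y (x≤a zero)
    case (suc i) = ≈-refl

  sort↓-decreasing : ∀ {d} {x : ℝ^ d} → Decreasing x → sort↓ x ≈ᵛ x
  sort↓-decreasing {suc d} {x} x↓ i = ≈-trans
    (insert-cons {x = sort↓ (tail x)}
      (λ j → ≤-trans (fwd (ih j)) (x↓ ℕ.z≤n))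
      (λ {i} {j} i≤j → ≤-trans (fwd (ih j)) (≤-trans (x↓ (ℕ.s≤s i≤j)) (bwd (ih i))))
      i)
    (case i)
    where
    ih : sort↓ (tail x) ≈ᵛ tail x
    ih = sort↓-decreasing λ i≤j → x↓ (ℕ.s≤s i≤j)
    case : ∀ i → (head x ∷ sort↓ (tail x)) i ≈ x i
    case zero    = ≈-refl
    case (suc i) = ih i

  -- Absolute values and sorting leave such an `x` unchanged, so on the cone of these vectors the
  -- norm is linear.
  orderedNorm-decreasing : ∀ {d} (w : ℝ^ d) {x} → Nonneg x → Decreasing x → orderedNorm w x ≈ w · x
  orderedNorm-decreasing w {x} 0≤x x↓ = ·-congʳ w λ i →
    ≈-trans (sort↓-decreasing (λ {i} {j} i≤j →
      ≤-trans (fwd (0≤x⇒∣x∣≈x (0≤x j))) (≤-trans (x↓ i≤j) (bwd (0≤x⇒∣x∣≈x (0≤x i))))) i)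
    (0≤x⇒∣x∣≈x (0≤x i))

  ·-distribˡ-+ : ∀ {d} (w x y : ℝ^ d) → w · zipWith _+_ x y ≈ w · x + w · y
  ·-distribˡ-+ w x y = ≈-trans (sum-cong-≋ λ i → distribˡ (w i) (x i) (y i))
    (∑-distrib-+ (λ i → w i * x i) (λ i → w i * y i))

  ·-*-assoc : ∀ {d} a (w x : ℝ^ d) → w · map (a *_) x ≈ a * (w · x)
  ·-*-assoc a w x = ≈-trans
    (sum-cong-≋ λ i → ≈-pointwise λ n → solve 3 (λ w a x → w :* (a :* x) := a :* (w :* x)) refl
      (seq (w i) n) (seq a n) (seq (x i) n))
    (≈-sym (*-distribˡ-sum a (zipWith _*_ w x)))
    where open ℚSolver.+-*-Solver

  module _ {d} {w : ℝ^ d} (isWeight : IsWeight w) where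

    weight-decreasing : Decreasing w
    weight-decreasing i≤j = wrap (IsWeight.decreasing isWeight i≤j)

    weight-nonneg : Nonneg w
    weight-nonneg i = wrap (IsWeight.nonneg isWeight i)

    private
      w↓ = weight-decreasing
      0≤w = weight-nonneg

    orderedNorm-mono : ∀ {x y} → (∀ i → ∣ x i ∣ ≲ ∣ y i ∣) → orderedNorm w x ≲ orderedNorm w y
    orderedNorm-mono = ·-sort↓-mono w↓ 0≤w

    orderedNorm-cong : ∀ {x y} → x ≈ᵛ y → orderedNorm w x ≈ orderedNorm w y
    orderedNorm-cong x≈y =
      orderedNorm-mono (λ i → fwd (∣-∣-cong (x≈y i))) ⇄ orderedNorm-mono (λ i → bwd (∣-∣-cong (x≈y i)))

    -- One `σ` serves both summands, and each of the two products is at most its sorted value.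
    orderedNorm-triangle : ∀ x y → orderedNorm w (zipWith _+_ x y) ≲ orderedNorm w x + orderedNorm w y
    orderedNorm-triangle x y = ·-sort↓-lub w ∣x+y∣ λ σ → begin
      w · ∣x+y∣ ⟪ σ ⟫
        ≤⟨ ·-monoʳ 0≤w (λ i → ∣-∣-triangle (x (σ ⟨$⟩ʳ i)) (y (σ ⟨$⟩ʳ i))) ⟩
      w · zipWith _+_ (map ∣_∣ x ⟪ σ ⟫) (map ∣_∣ y ⟪ σ ⟫)
        ≈⟨ ·-distribˡ-+ w (map ∣_∣ x ⟪ σ ⟫) (map ∣_∣ y ⟪ σ ⟫) ⟩
      w · map ∣_∣ x ⟪ σ ⟫ + w · map ∣_∣ y ⟪ σ ⟫
        ≤⟨ +-mono-≤ (rearrangement (map ∣_∣ x) σ w↓) (rearrangement (map ∣_∣ y) σ w↓) ⟩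
      orderedNorm w x + orderedNorm w y ∎
      where
      ∣x+y∣ : ℝ^ d
      ∣x+y∣ = map ∣_∣ (zipWith _+_ x y)

    orderedNorm-homogeneous : ∀ a x → orderedNorm w (map (a *_) x) ≈ ∣ a ∣ * orderedNorm w x
    orderedNorm-homogeneous a x = ·-sort↓-lub w ∣ax∣ (λ σ → begin
        w · ∣ax∣ ⟪ σ ⟫                            ≈⟨ pull σ ⟩
        ∣ a ∣ * (w · map ∣_∣ x ⟪ σ ⟫)             ≤⟨ *-monoʳ-≤ ∣ a ∣ (∣-∣-nonneg a) (rearrangement (map ∣_∣ x) σ w↓) ⟩
        ∣ a ∣ * orderedNorm w x                  ∎)
      -- For the converse, `σ` is a permutation that sorts the absolute values of `x`, so that the
      -- norm of `x` is attained at it.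
      ⇄ ≤-stable λ k → sort↓-permutes (map ∣_∣ x) λ (σ , p) → k (begin
        ∣ a ∣ * orderedNorm w x                  ≈⟨ *-congʳ ∣ a ∣ (·-congʳ w p) ⟩
        ∣ a ∣ * (w · map ∣_∣ x ⟪ σ ⟫)             ≈⟨ pull σ ⟨
        w · ∣ax∣ ⟪ σ ⟫                            ≤⟨ rearrangement ∣ax∣ σ w↓ ⟩
        orderedNorm w (map (a *_) x)             ∎)
      where
      ∣ax∣ : ℝ^ d
      ∣ax∣ = map ∣_∣ (map (a *_) x)
      pull : ∀ σ → w · ∣ax∣ ⟪ σ ⟫ ≈ ∣ a ∣ * (w · map ∣_∣ x ⟪ σ ⟫)
      pull σ = ≈-trans (·-congʳ w λ i → ∣-∣-homo-* a (x (σ ⟨$⟩ʳ i))) (·-*-assoc ∣ a ∣ w (map ∣_∣ x ⟪ σ ⟫))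

    orderedNorm-symmetric : ∀ π x → orderedNorm w (x ⟪ π ⟫) ≈ orderedNorm w x
    orderedNorm-symmetric π x = le π x ⇄ ≤-trans
      -- For the converse, `x` is itself the rearrangement of `x ⟪ π ⟫` by the inverse permutation.
      (fwd (orderedNorm-cong λ i → subst (λ j → x i ≈ x j) (sym (Perm.inverseʳ π)) ≈-refl))
      (le (Perm.flip π) (x ⟪ π ⟫))
      where
      le : ∀ π x → orderedNorm w (x ⟪ π ⟫) ≲ orderedNorm w x
      le π x = ·-sort↓-lub w (map ∣_∣ (x ⟪ π ⟫)) λ σ → rearrangement (map ∣_∣ x) (σ ∘ₚ π) w↓

  -- If `∣ x i ∣` were positive, moving that entry to the front would give `head w * ∣ x i ∣ ≲ 0ℝ`;
  -- the largest weight would vanish, and with it all of `w`.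
  orderedNorm-definite : ∀ {d} {w : ℝ^ d} → IsWeight w → ∀ {x} → orderedNorm w x ≈ 0ℝ → x ≈ᵛ 0ᵛ
  orderedNorm-definite {suc d} {w} W {x} h i = ∣x∣≤0⇒x≈0 (≤-stable λ k → ≰⇒> k λ 0<∣xᵢ∣ →
    IsWeight.nonzero W λ j → ≈⇒≃ (≤-trans (weight-decreasing W ℕ.z≤n) (w₀≤0 0<∣xᵢ∣) ⇄ weight-nonneg W j))
    where
    w₀∣xᵢ∣≤0 : head w * ∣ x i ∣ ≲ 0ℝ
    w₀∣xᵢ∣≤0 = begin
      head w * ∣ x i ∣
        ≈⟨ +-identityʳ _ ⟨
      head w * ∣ x i ∣ + 0ℝ
        ≤⟨ +-mono-≤ ≤-refl (sum-nonneg λ j → *-nonneg (weight-nonneg W (suc j)) (∣-∣-nonneg _)) ⟩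
      w · map ∣_∣ x ⟪ Perm.transpose zero i ⟫
        ≤⟨ rearrangement (map ∣_∣ x) (Perm.transpose zero i) (weight-decreasing W) ⟩
      orderedNorm w x
        ≈⟨ h ⟩
      0ℝ ∎
    w₀≤0 : 0ℝ < ∣ x i ∣ → head w ≲ 0ℝ
    w₀≤0 0<∣xᵢ∣ = ≤-stable λ k → ≰⇒> k λ 0<w₀ → <⇒≱ (*-pos {head w} {∣ x i ∣} 0<w₀ 0<∣xᵢ∣) w₀∣xᵢ∣≤0
      where
      *-pos : ∀ {x y} → 0ℝ < x → 0ℝ < y → 0ℝ < x * y
      *-pos {x} {y} (γ , 0<γ , M , p) (δ , 0<δ , N , q) =
        γ ℚ.* δ , ℚₚ.positive⁻¹ (γ ℚ.* δ) {{ℚₚ.pos*pos⇒pos γ {{ℚ.positive 0<γ}} δ {{ℚ.positive 0<δ}}}} ,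
        M ℕ.⊔ N , λ n n≥ →
          let γ≤x = subst (ℚ._≤ seq x n) (ℚₚ.+-identityˡ γ) (p n (⊔-≤ˡ n≥))
          in subst (ℚ._≤ seq x n ℚ.* seq y n) (sym (ℚₚ.+-identityˡ (γ ℚ.* δ)))
            (*-mono (ℚₚ.<⇒≤ 0<γ)
              (ℚₚ.≤-trans (ℚₚ.<⇒≤ 0<δ) (δ≤y n n≥)) γ≤x (δ≤y n n≥))
        where
        δ≤y : ∀ n → M ℕ.⊔ N ℕ.≤ n → δ ℚ.≤ seq y n
        δ≤y n n≥ = subst (ℚ._≤ seq y n) (ℚₚ.+-identityˡ δ) (q n (⊔-≤ʳ {M} n≥))

  ordered⇒symmetricMonotonic : ∀ {d} {f : ℝ^ d → ℝ} → IsOrderedNorm d f → IsSymmetricMonotonicNorm d f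
  ordered⇒symmetricMonotonic {d} {f} (w , W , f≃) = record
    { isNorm = record
      { congruent   = λ {x} {y} x≋y → ≈⇒≃ (via (orderedNorm-cong W λ i → ≃⇒≈ (x≋y i)))
      ; triangle    = λ x y → unwrap (≤-trans (fwd (f≈ (zipWith _+_ x y))) (≤-trans (orderedNorm-triangle W x y)
                        (bwd (+-cong (f≈ x) (f≈ y)))))
      ; homogeneous = λ a x → ≈⇒≃ (≈-trans (f≈ (map (a *_) x)) (≈-trans (orderedNorm-homogeneous W a x)
                        (*-congʳ ∣ a ∣ (≈-sym (f≈ x)))))
      ; definite    = λ {x} fx≃0 i → ≈⇒≃ (orderedNorm-definite W (≈-trans (≈-sym (f≈ x)) (≃⇒≈ fx≃0)) i) }
    ; symmetric = λ π x → ≈⇒≃ (via (orderedNorm-symmetric W π x))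
    ; monotonic = λ {x} {y} 0≤x x≤y → unwrap (≤-trans (fwd (f≈ x)) (≤-trans
        (orderedNorm-mono W λ i → ∣-∣-mono (wrap (0≤x i)) (wrap (x≤y i))) (bwd (f≈ y)))) }
    where
    f≈ : ∀ x → f x ≈ orderedNorm w x
    f≈ x = ≃⇒≈ (f≃ x)
    via : ∀ {x y} → orderedNorm w x ≈ orderedNorm w y → f x ≈ f y
    via {x} {y} h = ≈-trans (f≈ x) (≈-trans h (≈-sym (f≈ y)))
    ∣-∣-mono : ∀ {x y} → 0ℝ ≲ x → x ≲ y → ∣ x ∣ ≲ ∣ y ∣
    ∣-∣-mono 0≤x x≤y = ≤-trans (fwd (0≤x⇒∣x∣≈x 0≤x)) (≤-trans x≤y x≤∣x∣)

open OrderedNorms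

-- Natural numbers among the reals, and vectors with natural entries.

/1-homo-* : ∀ m n → + m ℚ./ 1 ℚ.* (+ n ℚ./ 1) ≡ + (m ℕ.* n) ℚ./ 1
/1-homo-* zero    n = ℚₚ.*-zeroˡ (+ n ℚ./ 1)
/1-homo-* (suc m) n = begin
  + suc m ℚ./ 1 ℚ.* n/1               ≡⟨ cong (ℚ._* n/1) (sym (/1-homo-+ 1 m)) ⟩
  (1ℚ ℚ.+ + m ℚ./ 1) ℚ.* n/1          ≡⟨ ℚₚ.*-distribʳ-+ n/1 1ℚ (+ m ℚ./ 1) ⟩
  1ℚ ℚ.* n/1 ℚ.+ + m ℚ./ 1 ℚ.* n/1    ≡⟨ cong₂ ℚ._+_ (ℚₚ.*-identityˡ n/1) (/1-homo-* m n) ⟩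
  n/1 ℚ.+ + (m ℕ.* n) ℚ./ 1           ≡⟨ /1-homo-+ n (m ℕ.* n) ⟩
  + (suc m ℕ.* n) ℚ./ 1               ∎
  where
  open ≡-Reasoning
  n/1 : ℚ
  n/1 = + n ℚ./ 1

/1-mono-≤ : ∀ {m n} → m ℕ.≤ n → + m ℚ./ 1 ℚ.≤ + n ℚ./ 1
/1-mono-≤ {m} {n} h = ℚₚ.toℚᵘ-cancel-≤ (begin
  toℚᵘ (+ m ℚ./ 1)   ≃⟨ ℚₚ.toℚᵘ-fromℚᵘ (ℚᵘ.mkℚᵘ (+ m) 0) ⟩
  ℚᵘ.mkℚᵘ (+ m) 0    ≤⟨ mkℚᵘ-≤ (ℕₚ.*-monoˡ-≤ 1 h) ⟩
  ℚᵘ.mkℚᵘ (+ n) 0    ≃⟨ ℚₚ.toℚᵘ-fromℚᵘ (ℚᵘ.mkℚᵘ (+ n) 0) ⟨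
  toℚᵘ (+ n ℚ./ 1)   ∎)
  where open ℚᵘₚ.≤-Reasoning

fromℕ-+ : ∀ m n → fromℕ m + fromℕ n ≈ fromℕ (m ℕ.+ n)
fromℕ-+ m n = ≈-pointwise λ _ → /1-homo-+ m n

fromℕ-* : ∀ m n → fromℕ m * fromℕ n ≈ fromℕ (m ℕ.* n)
fromℕ-* m n = ≈-pointwise λ _ → /1-homo-* m n

fromℕ-mono-≤ : ∀ {m n} → m ℕ.≤ n → fromℕ m ≲ fromℕ n
fromℕ-mono-≤ h = ≤-pointwise λ _ → /1-mono-≤ h

-- Distinct natural numbers are at least 1 apart, and this gap witnesses `<`.
fromℕ-cancel-≤ : ∀ {m n} → fromℕ m ≲ fromℕ n → m ℕ.≤ n
fromℕ-cancel-≤ {m} {n} h = ℕₚ.≮⇒≥ λ n<m → <⇒≱ (1ℚ , 0<1 , 0 , λ _ _ → n+1≤m n<m) h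
  where
  n+1≤m : n ℕ.< m → + n ℚ./ 1 ℚ.+ 1ℚ ℚ.≤ + m ℚ./ 1
  n+1≤m n<m = subst (ℚ._≤ + m ℚ./ 1)
    (trans (cong (λ k → + k ℚ./ 1) (ℕₚ.+-comm 1 n)) (sym (/1-homo-+ n 1))) (/1-mono-≤ n<m)

fromℕ-nonneg : ∀ n → 0ℝ ≲ fromℕ n
fromℕ-nonneg n = fromℕ-mono-≤ {0} {n} ℕ.z≤n

-- Vertices and weights are functions on `ℕ` cut off at `d`, so that their products are computed by
-- `Σ<` in `ℕ`.
embed : ∀ d → (ℕ → ℕ) → ℝ^ d
embed d f i = fromℕ (f (toℕ i))

sum-embed : ∀ d f → sum (embed d f) ≈ fromℕ (Σ< d f)
sum-embed zero    f = ≈-refl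
sum-embed (suc d) f = ≈-trans (+-congˡ {fromℕ (f 0)} (sum-embed d (f ∘ suc))) (fromℕ-+ (f 0) (Σ< d (f ∘ suc)))

embed-· : ∀ d f g → embed d f · embed d g ≈ fromℕ (Σ< d λ x → f x ℕ.* g x)
embed-· d f g = ≈-trans (sum-cong-≋ {d} λ i → fromℕ-* (f (toℕ i)) (g (toℕ i))) (sum-embed d λ x → f x ℕ.* g x)

embed-nonneg : ∀ d f → Nonneg (embed d f)
embed-nonneg d f i = fromℕ-nonneg (f (toℕ i))

embed-decreasing : ∀ d {f} → (∀ {x y} → x ℕ.≤ y → f y ℕ.≤ f x) → Decreasing (embed d f)
embed-decreasing d h i≤j = fromℕ-mono-≤ (h i≤j)

embed-isWeight : ∀ d {f} → 1 ℕ.≤ d → (∀ {x y} → x ℕ.≤ y → f y ℕ.≤ f x) → 1 ℕ.≤ f 0 → IsWeight (embed d f)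
embed-isWeight (suc d) {f} _ h 1≤f0 = record
  { decreasing = λ i≤j → unwrap (embed-decreasing (suc d) h i≤j)
  ; nonneg     = λ i → unwrap (embed-nonneg (suc d) f i)
  ; nonzero    = λ w≋0 → ℕₚ.n≮0 (ℕₚ.≤-trans 1≤f0 (fromℕ-cancel-≤ (fwd (≃⇒≈ (w≋0 zero))))) }

-- Convex hulls.

module _ {d n} {v : Vector (ℝ^ d) n} {x : ℝ^ d} where

  hull-nonneg : (∀ j → Nonneg (v j)) → x ∈ ConvexHull v → Nonneg x
  hull-nonneg 0≤v (μ , 0≤μ , _ , x≃) i = ≤-trans
    (sum-nonneg λ j → *-nonneg (wrap (0≤μ j)) (0≤v j i)) (bwd (≃⇒≈ (x≃ i)))

  hull-decreasing : (∀ j → Decreasing (v j)) → x ∈ ConvexHull v → Decreasing x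
  hull-decreasing v↓ (μ , 0≤μ , _ , x≃) {i} {i′} i≤i′ = begin
    x i′                  ≈⟨ ≃⇒≈ (x≃ i′) ⟩
    μ · (λ j → v j i′)    ≤⟨ ·-monoʳ (λ j → wrap (0≤μ j)) (λ j → v↓ j i≤i′) ⟩
    μ · (λ j → v j i)     ≈⟨ ≃⇒≈ (x≃ i) ⟨
    x i                   ∎
    where open ≤-Reasoning

  -- By an exchange of two finite sums, a linear functional at a point of the hull is the average of
  -- its values at the vertices with weights `μ`.
  hull-functional-≥ : ∀ (w : ℝ^ d) {c} → (∀ j → c ≲ w · v j) → x ∈ ConvexHull v → c ≲ w · x
  hull-functional-≥ w {c} h (μ , 0≤μ , Σμ≃1 , x≃) = begin
    c                                                ≈⟨ *-identityʳ c ⟨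
    c * 1ℝ                                           ≈⟨ *-congʳ c (≃⇒≈ Σμ≃1) ⟨
    c * sum μ                                        ≈⟨ *-distribˡ-sum c μ ⟩
    sum (λ j → c * μ j)                              ≤⟨ sum-mono (λ j → *-monoˡ-≤ (μ j) (wrap (0≤μ j)) (h j)) ⟩
    sum (λ j → w · v j * μ j)                        ≈⟨ sum-cong-≋ (λ j → *-distribʳ-sum (μ j) (zipWith _*_ w (v j))) ⟩
    sum (λ j → sum (λ i → w i * v j i * μ j))        ≈⟨ ∑-comm (λ j i → w i * v j i * μ j) ⟩
    sum (λ i → sum (λ j → w i * v j i * μ j))        ≈⟨ sum-cong-≋ (λ i → ≈-trans
                                                         (sum-cong-≋ λ j → ≈-pointwise λ n → solve 3
                                                           (λ w v μ → w :* v :* μ := w :* (μ :* v)) refl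
                                                           (seq (w i) n) (seq (v j i) n) (seq (μ j) n))
                                                         (≈-sym (*-distribˡ-sum (w i) (λ j → μ j * v j i)))) ⟩
    sum (λ i → w i * (μ · (λ j → v j i)))            ≈⟨ ·-congʳ w (λ i → ≃⇒≈ (x≃ i)) ⟨
    w · x                                            ∎
    where
    open ≤-Reasoning
    open ℚSolver.+-*-Solver

unit : ∀ {n} → Fin n → ℝ^ n
unit zero    zero    = 1ℝ
unit zero    (suc k) = 0ℝ
unit (suc j) zero    = 0ℝ
unit (suc j) (suc k) = unit j k

unit-nonneg : ∀ {n} (j : Fin n) → Nonneg (unit j)
unit-nonneg zero    zero    = fromℕ-nonneg 1
unit-nonneg zero    (suc k) = ≤-refl
unit-nonneg (suc j) zero    = ≤-refl
unit-nonneg (suc j) (suc k) = unit-nonneg j k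

unit-· : ∀ {n} (j : Fin n) (x : ℝ^ n) → unit j · x ≈ x j
unit-· {suc n} zero x = begin-equality
  1ℝ * x zero + 0ᵛ · (x ∘ suc)   ≈⟨ +-cong (*-identityˡ (x zero)) (≈-sym (*-distribˡ-sum 0ℝ (x ∘ suc))) ⟩
  x zero + 0ℝ * sum (x ∘ suc)    ≈⟨ +-congˡ (zeroˡ (sum (x ∘ suc))) ⟩
  x zero + 0ℝ                    ≈⟨ +-identityʳ (x zero) ⟩
  x zero                         ∎
  where open ≤-Reasoning
unit-· {suc n} (suc j) x = begin-equality
  0ℝ * x zero + unit j · (x ∘ suc)   ≈⟨ +-cong (zeroˡ (x zero)) (unit-· j (x ∘ suc)) ⟩
  0ℝ + x (suc j)                     ≈⟨ +-identityˡ (x (suc j)) ⟩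
  x (suc j)                          ∎
  where open ≤-Reasoning

vertex∈hull : ∀ {d n} (v : Vector (ℝ^ d) n) j → v j ∈ ConvexHull v
vertex∈hull v j = unit j , (λ k → unwrap (unit-nonneg j k)) ,
  ≈⇒≃ (≈-trans (sum-cong-≋ λ k → ≈-sym (*-identityʳ (unit j k))) (unit-· j λ _ → 1ℝ)) ,
  λ i → ≈⇒≃ (≈-sym (unit-· j λ k → v k i))

-- Binary digits and finite choice.

bits : ∀ m → Fin (2 ℕ.^ m) → Vec Bool m
bits zero    _ = Vec.[]
bits (suc m) k = let (q , r) = remQuot (2 ℕ.^ m) k in Inverse.to Finₚ.2↔Bool q Vec.∷ bits m r

bits-injective : ∀ m {i j} → bits m i ≡ bits m j → i ≡ j
bits-injective zero    {zero} {zero} _ = refl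
bits-injective (suc m) {i} {j} eq = trans (sym (Finₚ.combine-remQuot {2} (2 ℕ.^ m) i))
  (trans (cong₂ Fin.combine (Injection.injective (↔⇒↣ Finₚ.2↔Bool) (Vecₚ.∷-injectiveˡ eq))
                        (bits-injective m (Vecₚ.∷-injectiveʳ eq)))
    (Finₚ.combine-remQuot {2} (2 ℕ.^ m) j))

-- Double negation is a monad and so commutes with finite products. A portfolio provides its point
-- for each norm only up to double negation.
¬¬-choice : ∀ {m n} {P : Fin m → Fin n → Set} → (∀ i → ¬ ¬ (∃[ j ] P i j)) →
  ¬ ¬ (∃[ g ] ∀ i → P i (g i))
¬¬-choice h k = Finₚ.sequence (RawMonad.rawApplicative ¬¬-Monad) h λ s → k ((proj₁ ∘ s) , (proj₂ ∘ s))

-- The polytope for given `R` and `m`, and the size of its portfolios.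

module Construction (R : ℕ) (1<R : 1 ℕ.< R) (m : ℕ) where
  open Profile R 1<R

  dim : ℕ
  dim = size (m ℕ.* 2)

  1≤dim : 1 ℕ.≤ dim
  1≤dim = ℕₚ.m^n>0 (R ℕ.* R) {{ℕ.>-nonZero (ℕₚ.*-mono-≤ (ℕₚ.<⇒≤ 1<R) (ℕₚ.<⇒≤ 1<R))}} (m ℕ.* 2)

  vertex weight : Vector (ℝ^ dim) (2 ℕ.^ m)
  vertex j = embed dim (profile (code (bits m j)))
  weight j = embed dim (profile (Vec.map not (code (bits m j))))

  weight-isWeight : ∀ j → IsWeight (weight j)
  weight-isWeight j = embed-isWeight dim 1≤dim
    (profile-antitone (Vec.map not (code (bits m j)))) (1≤profile (Vec.map not (code (bits m j))) 0)

  vertex-nonneg : ∀ j → Nonneg (vertex j)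
  vertex-nonneg j = embed-nonneg dim (profile (code (bits m j)))

  vertex-decreasing : ∀ j → Decreasing (vertex j)
  vertex-decreasing j = embed-decreasing dim (profile-antitone (code (bits m j)))

  pairing : Fin (2 ℕ.^ m) → Fin (2 ℕ.^ m) → ℕ
  pairing i j = dot (Vec.map not (code (bits m i))) (code (bits m j))

  weight-·-vertex : ∀ i j → weight i · vertex j ≈ fromℕ (pairing i j)
  weight-·-vertex i j =
    embed-· dim (profile (Vec.map not (code (bits m i)))) (profile (code (bits m j)))

  -- An upper bound for `norm i` at its own vertex, and twice a lower bound for it at any other
  -- vertex; `high` over `low` is `R` divided by `suc (m * 2)`.
  low high : ℕ
  low  = suc (m ℕ.* 2) ℕ.* R ℕ.* dim
  high = R ℕ.* R ℕ.* dim

  norm : Fin (2 ℕ.^ m) → ℝ^ dim → ℝ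
  norm i = orderedNorm (weight i)

  norm-hull : ∀ i {x} → x ∈ ConvexHull vertex → norm i x ≈ weight i · x
  norm-hull i x∈ = orderedNorm-decreasing (weight i)
    (hull-nonneg vertex-nonneg x∈) (hull-decreasing vertex-decreasing x∈)

  norm-vertex-≤ : ∀ i → norm i (vertex i) ≲ fromℕ low
  norm-vertex-≤ i = begin
    norm i (vertex i)        ≈⟨ orderedNorm-decreasing (weight i) (vertex-nonneg i) (vertex-decreasing i) ⟩
    weight i · vertex i      ≈⟨ weight-·-vertex i i ⟩
    fromℕ (pairing i i)      ≤⟨ fromℕ-mono-≤ (dot-not-≤ (code (bits m i))) ⟩
    fromℕ low                ∎
    where open ≤-Reasoning

  -- Every vertex is bad for at least one of two distinct norms, and both are linear on the hull.
  norm-pair-≥ : ∀ {i i′ x} → i ≢ i′ → x ∈ ConvexHull vertex →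
    fromℕ high ≲ fromℕ 2 * (norm i x + norm i′ x)
  norm-pair-≥ {i} {i′} {x} i≢i′ x∈ = begin
    fromℕ high                                ≤⟨ hull-functional-≥ (λ k → fromℕ 2 * (weight i k + weight i′ k)) bad x∈ ⟩
    (λ k → fromℕ 2 * (weight i k + weight i′ k)) · x
                                              ≈⟨ pair-· x ⟩
    fromℕ 2 * (weight i · x + weight i′ · x)  ≈⟨ *-congʳ (fromℕ 2) (+-cong (norm-hull i x∈) (norm-hull i′ x∈)) ⟨
    fromℕ 2 * (norm i x + norm i′ x)          ∎
    where
    open ≤-Reasoning
    pair-· : ∀ y → (λ k → fromℕ 2 * (weight i k + weight i′ k)) · y ≈ fromℕ 2 * (weight i · y + weight i′ · y)
    pair-· y = ≈-trans
      (sum-cong-≋ λ k → ≈-pointwise λ n → solve 4 (λ a b c y → a :* (b :+ c) :* y := a :* (b :* y :+ c :* y)) refl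
        (seq (fromℕ 2) n) (seq (weight i k) n) (seq (weight i′ k) n) (seq (y k) n))
      (≈-trans (≈-sym (*-distribˡ-sum (fromℕ 2) λ k → weight i k * y k + weight i′ k * y k))
        (*-congʳ (fromℕ 2) (∑-distrib-+ (zipWith _*_ (weight i) y) (zipWith _*_ (weight i′) y))))
      where open ℚSolver.+-*-Solver
    high≤ : ∀ j → high ℕ.≤ 2 ℕ.* (pairing i j ℕ.+ pairing i′ j)
    high≤ j with i Finₚ.≟ j
    ... | no i≢j   = ℕₚ.≤-trans (dot-code-≥ (bits m i) (bits m j) (i≢j ∘ bits-injective m))
                       (ℕₚ.*-monoʳ-≤ 2 (ℕₚ.m≤m+n (pairing i j) (pairing i′ j)))
    ... | yes refl = ℕₚ.≤-trans (dot-code-≥ (bits m i′) (bits m i) (i≢i′ ∘ sym ∘ bits-injective m))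
                       (ℕₚ.*-monoʳ-≤ 2 (ℕₚ.m≤n+m (pairing i′ i) (pairing i i)))
    bad : ∀ j → fromℕ high ≲ (λ k → fromℕ 2 * (weight i k + weight i′ k)) · vertex j
    bad j = begin
      fromℕ high                                             ≤⟨ fromℕ-mono-≤ (high≤ j) ⟩
      fromℕ (2 ℕ.* (pairing i j ℕ.+ pairing i′ j))           ≈⟨ fromℕ-* 2 (pairing i j ℕ.+ pairing i′ j) ⟨
      fromℕ 2 * fromℕ (pairing i j ℕ.+ pairing i′ j)         ≈⟨ *-congʳ (fromℕ 2) (fromℕ-+ (pairing i j) (pairing i′ j)) ⟨
      fromℕ 2 * (fromℕ (pairing i j) + fromℕ (pairing i′ j)) ≈⟨ *-congʳ (fromℕ 2)
                                                                 (+-cong (weight-·-vertex i j) (weight-·-vertex i′ j)) ⟨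
      fromℕ 2 * (weight i · vertex j + weight i′ · vertex j) ≈⟨ pair-· (vertex j) ⟨
      (λ k → fromℕ 2 * (weight i k + weight i′ k)) · vertex j ∎

  -- With fewer than `2 ^ m` points, two norms would share a point that is good for both, against
  -- `norm-pair-≥`. The condition on `R` makes `high` exceed `4 * A * low`.
  portfolio-size : ∀ {α A} → α ≲ fromℕ A → 4 ℕ.* A ℕ.* suc (m ℕ.* 2) ℕ.< R →
    ∀ {𝐂} → IsOrderedNorm dim ⊆ 𝐂 → ∀ {X} → IsPortfolio α 𝐂 (ConvexHull vertex) X →
    ∀ {N} → HasSizeAtMost X N → 2 ℕ.^ m ℕ.≤ N
  portfolio-size {α} {A} α≤A A<R {𝐂} ordered⊆𝐂 {X} isPortfolio {N} (e , cover) = ℕₚ.≮⇒≥ λ N<2^m →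
    -- The goal is absurdity, so the choice of a listed point for every norm may be taken out of the
    -- double negation.
    ¬¬-choice served λ (g , good) →
    let (i , i′ , i<i′ , gi≡gi′) = Finₚ.pigeonhole N<2^m g
        (x , x∈X , x≋ , fx≤)      = good i
        (x′ , _  , x′≋ , fx′≤)    = good i′
    in clash (Finₚ.<⇒≢ i<i′) (IsPortfolio.subset isPortfolio x∈X) fx≤ (≤-trans
         -- `x` and `x′` agree with the same listed point only coordinatewise, so the bound is
         -- carried over from `x′` to `x`.
         (fwd (orderedNorm-cong (weight-isWeight i′) λ k →
           ≈-trans (≃⇒≈ (x≋ k)) (≈-trans (subst (λ j → e (g i) k ≈ e j k) gi≡gi′ ≈-refl) (≈-sym (≃⇒≈ (x′≋ k))))))
         fx′≤)
    where
    open ≤-Reasoning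
    Serves : Fin (2 ℕ.^ m) → Fin N → Set
    Serves i j = ∃[ x ] (x ∈ X × x ≋ e j × norm i x ≲ fromℕ (A ℕ.* low))
    served : ∀ i → ¬ ¬ (∃[ j ] Serves i j)
    -- The competitor in the polytope is vertex `i`, where the norm is at most `low`.
    served i k = IsPortfolio.approx isPortfolio (ordered⊆𝐂 {norm i} (weight i , weight-isWeight i , λ x → ≈⇒≃ (≈-refl {norm i x})))
      (vertex∈hull vertex i) λ (x , x∈X , fx≤) → k (proj₁ (cover x∈X) , x , x∈X , proj₂ (cover x∈X) , (begin
        norm i x                  ≤⟨ wrap fx≤ ⟩
        α * norm i (vertex i)     ≤⟨ *-monoˡ-≤ (norm i (vertex i)) (norm-nonneg i) α≤A ⟩
        fromℕ A * norm i (vertex i) ≤⟨ *-monoʳ-≤ (fromℕ A) (fromℕ-nonneg A) (norm-vertex-≤ i) ⟩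
        fromℕ A * fromℕ low       ≈⟨ fromℕ-* A low ⟩
        fromℕ (A ℕ.* low)         ∎))
      where
      norm-nonneg : ∀ i → 0ℝ ≲ norm i (vertex i)
      norm-nonneg i = ≤-trans (sum-nonneg λ k → *-nonneg (weight-nonneg (weight-isWeight i) k) (vertex-nonneg i k))
        (bwd (orderedNorm-decreasing (weight i) (vertex-nonneg i) (vertex-decreasing i)))
    clash : ∀ {i i′ x} → i ≢ i′ → x ∈ ConvexHull vertex →
      norm i x ≲ fromℕ (A ℕ.* low) → norm i′ x ≲ fromℕ (A ℕ.* low) → ⊥
    clash {i} {i′} {x} i≢i′ x∈ p p′ = ℕₚ.<⇒≱ too-small (fromℕ-cancel-≤ (begin
      fromℕ high                                     ≤⟨ norm-pair-≥ i≢i′ x∈ ⟩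
      fromℕ 2 * (norm i x + norm i′ x)               ≤⟨ *-monoʳ-≤ (fromℕ 2) (fromℕ-nonneg 2) (+-mono-≤ p p′) ⟩
      fromℕ 2 * (fromℕ (A ℕ.* low) + fromℕ (A ℕ.* low)) ≈⟨ *-congʳ (fromℕ 2) (fromℕ-+ (A ℕ.* low) (A ℕ.* low)) ⟩
      fromℕ 2 * fromℕ (A ℕ.* low ℕ.+ A ℕ.* low)      ≈⟨ fromℕ-* 2 (A ℕ.* low ℕ.+ A ℕ.* low) ⟩
      fromℕ (2 ℕ.* (A ℕ.* low ℕ.+ A ℕ.* low))        ∎))
      where
      too-small : 2 ℕ.* (A ℕ.* low ℕ.+ A ℕ.* low) ℕ.< high
      too-small = subst (ℕ._< high)
        (solve 4 (λ a s r d → con 4 :* a :* s :* (r :* d) := con 2 :* (a :* (s :* r :* d) :+ a :* (s :* r :* d)))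
          refl A (suc (m ℕ.* 2)) R dim)
        (subst (4 ℕ.* A ℕ.* suc (m ℕ.* 2) ℕ.* (R ℕ.* dim) ℕ.<_) (sym (ℕₚ.*-assoc R R dim))
          (ℕₚ.*-monoˡ-< (R ℕ.* dim) {{ℕ.>-nonZero (ℕₚ.*-mono-≤ {1} {R} {1} {dim} (ℕₚ.<⇒≤ 1<R) 1≤dim)}} A<R))
        where open ℕSolver.+-*-Solver

-- Bounds for logarithms, and the form of the size bound.

module _ (q : ℚ) where
  private
    q₁ : ℚ
    q₁ = q ℚ.⊔ 1ℚ

    0≤q₁ : 0ℚ ℚ.≤ q₁
    0≤q₁ = ℚₚ.≤-trans (ℚₚ.<⇒≤ 0<1) (ℚₚ.p≤q⊔p q 1ℚ)

    0≤1 : 0ℚ ℚ.≤ 1ℚ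
    0≤1 = ℚₚ.<⇒≤ 0<1

    power : ∀ e n → 2 ℕ.^ (e ℕ.* n) ℕ.* ↧ₙ q₁ ℕ.^ n ≡ (2 ℕ.^ e ℕ.* ↧ₙ q₁) ℕ.^ n
    power e n = trans (cong (ℕ._* ↧ₙ q₁ ℕ.^ n) (sym (ℕₚ.^-*-assoc 2 e n)))
      (sym (NatLog.^-distribʳ-* (2 ℕ.^ e) (↧ₙ q₁) n))

  -- The hypothesis is raised to the power `suc n`, and the rounded logarithm is exact at powers of
  -- two. So the bound holds for each approximant without an error term.
  log₂-approx-≥ : ∀ {e} n → + (2 ℕ.^ e) ℚ./ 1 ℚ.≤ q → + e ℚ./ 1 ℚ.≤ log₂-approx q n
  log₂-approx-≥ {e} n h = ℚₚ.toℚᵘ-cancel-≤ (begin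
    toℚᵘ (+ e ℚ./ 1)              ≃⟨ ℚₚ.toℚᵘ-fromℚᵘ (ℚᵘ.mkℚᵘ (+ e) 0) ⟩
    ℚᵘ.mkℚᵘ (+ e) 0               ≤⟨ mkℚᵘ-≤ (subst (e ℕ.* suc n ℕ.≤_) (sym (ℕₚ.*-identityʳ _)) log≥) ⟩
    ℚᵘ.mkℚᵘ (+ ⌊log₂ q ^ suc n ⌋) n  ≃⟨ ℚₚ.toℚᵘ-fromℚᵘ (ℚᵘ.mkℚᵘ (+ ⌊log₂ q ^ suc n ⌋) n) ⟨
    toℚᵘ (log₂-approx q n)        ∎)
    where
    open ℚᵘₚ.≤-Reasoning
    instance _ = ℕₚ.m^n≢0 (↧ₙ q₁) (suc n)
    base : 2 ℕ.^ e ℕ.* ↧ₙ q₁ ℕ.≤ num q₁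
    base = subst₂ ℕ._≤_
      (cong (2 ℕ.^ e ℕ.*_) (ℕₚ.*-identityˡ (↧ₙ q₁)))
      (trans (ℕₚ.*-identityˡ _) (ℕₚ.*-identityʳ (num q₁)))
      (clear-denominators (2 ℕ.^ e) 1 {1ℚ} {q₁} 0≤1 0≤q₁
        (subst₂ ℚ._≤_ (sym (ℚₚ.*-identityʳ (+ (2 ℕ.^ e) ℚ./ 1))) (sym (ℚₚ.*-identityˡ q₁))
          (ℚₚ.≤-trans h (ℚₚ.p≤p⊔q q 1ℚ))))
    log≥ : e ℕ.* suc n ℕ.≤ ⌊log₂ q ^ suc n ⌋
    log≥ = subst (ℕ._≤ ⌊log₂ q ^ suc n ⌋) (⌊log₂[2^n]⌋≡n (e ℕ.* suc n)) (⌊log₂⌋-mono-≤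
      (subst (ℕ._≤ num q₁ ℕ.^ suc n ℕ./ ↧ₙ q₁ ℕ.^ suc n)
        (m*n/n≡m (2 ℕ.^ (e ℕ.* suc n)) (↧ₙ q₁ ℕ.^ suc n))
        (/-monoˡ-≤ (↧ₙ q₁ ℕ.^ suc n)
          (subst (ℕ._≤ num q₁ ℕ.^ suc n) (sym (power e (suc n))) (ℕₚ.^-monoˡ-≤ (suc n) base)))))

  log₂-approx-≤ : ∀ {e} n → q ℚ.≤ + (2 ℕ.^ e) ℚ./ 1 → log₂-approx q n ℚ.≤ + e ℚ./ 1
  log₂-approx-≤ {e} n h = ℚₚ.toℚᵘ-cancel-≤ (begin
    toℚᵘ (log₂-approx q n)        ≃⟨ ℚₚ.toℚᵘ-fromℚᵘ (ℚᵘ.mkℚᵘ (+ ⌊log₂ q ^ suc n ⌋) n) ⟩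
    ℚᵘ.mkℚᵘ (+ ⌊log₂ q ^ suc n ⌋) n  ≤⟨ mkℚᵘ-≤ (subst (ℕ._≤ e ℕ.* suc n) (sym (ℕₚ.*-identityʳ _)) log≤) ⟩
    ℚᵘ.mkℚᵘ (+ e) 0               ≃⟨ ℚₚ.toℚᵘ-fromℚᵘ (ℚᵘ.mkℚᵘ (+ e) 0) ⟨
    toℚᵘ (+ e ℚ./ 1)              ∎)
    where
    open ℚᵘₚ.≤-Reasoning
    instance _ = ℕₚ.m^n≢0 (↧ₙ q₁) (suc n)
    base : num q₁ ℕ.≤ 2 ℕ.^ e ℕ.* ↧ₙ q₁
    base = subst₂ ℕ._≤_
      (trans (ℕₚ.*-identityˡ _) (ℕₚ.*-identityʳ (num q₁)))
      (cong (2 ℕ.^ e ℕ.*_) (ℕₚ.*-identityˡ (↧ₙ q₁)))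
      (clear-denominators 1 (2 ℕ.^ e) {q₁} {1ℚ} 0≤q₁ 0≤1
        (subst₂ ℚ._≤_ (sym (ℚₚ.*-identityˡ q₁)) (sym (ℚₚ.*-identityʳ (+ (2 ℕ.^ e) ℚ./ 1)))
          -- The truncation at 1 is harmless because `1 ≤ 2 ^ e`.
          (ℚₚ.⊔-lub h (/1-mono-≤ (ℕₚ.m^n>0 2 e)))))
    log≤ : ⌊log₂ q ^ suc n ⌋ ℕ.≤ e ℕ.* suc n
    log≤ = subst (⌊log₂ q ^ suc n ⌋ ℕ.≤_) (⌊log₂[2^n]⌋≡n (e ℕ.* suc n)) (⌊log₂⌋-mono-≤
      (subst (num q₁ ℕ.^ suc n ℕ./ ↧ₙ q₁ ℕ.^ suc n ℕ.≤_)
        (m*n/n≡m (2 ℕ.^ (e ℕ.* suc n)) (↧ₙ q₁ ℕ.^ suc n))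
        (/-monoˡ-≤ (↧ₙ q₁ ℕ.^ suc n)
          (subst (num q₁ ℕ.^ suc n ℕ.≤_) (sym (power e (suc n))) (ℕₚ.^-monoˡ-≤ (suc n) base)))))

-- The constant `c`, the same for every `K`: the dimension will be 2 to the power `20 * (m * g)`.
1/20 : ℚ
1/20 = + 1 ℚ./ 20

1/20*20 : ∀ n → 1/20 ℚ.* (+ (20 ℕ.* n) ℚ./ 1) ≡ + n ℚ./ 1
1/20*20 n = begin
  1/20 ℚ.* (+ (20 ℕ.* n) ℚ./ 1)               ≡⟨ cong (1/20 ℚ.*_) (sym (/1-homo-* 20 n)) ⟩
  1/20 ℚ.* (+ 20 ℚ./ 1 ℚ.* (+ n ℚ./ 1))       ≡⟨ sym (ℚₚ.*-assoc 1/20 (+ 20 ℚ./ 1) (+ n ℚ./ 1)) ⟩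
  1/20 ℚ.* (+ 20 ℚ./ 1) ℚ.* (+ n ℚ./ 1)       ≡⟨ cong (ℚ._* (+ n ℚ./ 1)) (ℚₚ.*-inverseˡ (+ 20 ℚ./ 1)) ⟩
  1ℚ ℚ.* (+ n ℚ./ 1)                          ≡⟨ ℚₚ.*-identityˡ (+ n ℚ./ 1) ⟩
  + n ℚ./ 1                                   ∎
  where open ≡-Reasoning

log₂-≤ : ∀ x {e} → (∀ n → seq x n ℚ.≤ + (2 ℕ.^ e) ℚ./ 1) → log₂ x ≲ fromℕ e
log₂-≤ x {e} h = ≤-pointwise λ n → log₂-approx-≤ (seq x n) {e} n (h n)

log₂-≥ : ∀ x {e} → (∀ n → + (2 ℕ.^ e) ℚ./ 1 ℚ.≤ seq x n) → fromℕ e ≲ log₂ x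
log₂-≥ x {e} h = ≤-pointwise λ n → log₂-approx-≥ (seq x n) {e} n (h n)

log₂-log₂-≥ : ∀ x {e g} → 2 ℕ.^ g ℕ.≤ e → (∀ n → + (2 ℕ.^ e) ℚ./ 1 ℚ.≤ seq x n) →
  fromℕ g ≲ log₂ (log₂ x)
log₂-log₂-≥ x {e} {g} 2^g≤e h = log₂-≥ (log₂ x) {g} λ n →
  ℚₚ.≤-trans (/1-mono-≤ 2^g≤e) (log₂-approx-≥ (seq x n) {e} n (h n))

log₂-nonneg : ∀ x → 0ℝ ≲ log₂ x
log₂-nonneg x = ≤-pointwise λ n → ℚₚ.nonNegative⁻¹ (log₂-approx (seq x n) n)
  {{ℚₚ.normalize-nonNeg ⌊log₂ seq x n ^ suc n ⌋ (suc n)}}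

-- The left side is at most `m * g`. Here `m` is at most the logarithm of `N`, and `g` at most the
-- iterated logarithm of `d`, since `2 ^ g ≤ e`.
sizeBound : ∀ {d N m g e} → d ≡ 2 ℕ.^ e → e ≡ 20 ℕ.* (m ℕ.* g) →
  2 ℕ.^ m ℕ.≤ N → 2 ℕ.^ g ℕ.≤ e → SizeBound (fromℚ 1/20) d N
sizeBound {d} {N} {m} {g} {e} d≡2^e e≡20mg 2^m≤N 2^g≤e = unwrap {fromℚ 1/20 * log₂ (fromℕ d)} {log₂ (fromℕ N) * log₂ (log₂ (fromℕ d))} (begin
  c * log₂ (fromℕ d)
    ≤⟨ *-monoʳ-≤ {log₂ (fromℕ d)} {fromℕ e} c 0≤c (log₂-≤ (fromℕ d) {e} λ _ → /1-mono-≤ {d} {2 ℕ.^ e} (ℕₚ.≤-reflexive d≡2^e)) ⟩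
  c * fromℕ e
    ≈⟨ ≈-pointwise (λ _ → trans (cong (λ e → 1/20 ℚ.* (+ e ℚ./ 1)) e≡20mg) (1/20*20 (m ℕ.* g))) ⟩
  fromℕ (m ℕ.* g)
    ≈⟨ fromℕ-* m g ⟨
  fromℕ m * fromℕ g
    ≤⟨ *-monoˡ-≤ {fromℕ m} {log₂ (fromℕ N)} (fromℕ g) (fromℕ-nonneg g) (log₂-≥ (fromℕ N) {m} λ _ → /1-mono-≤ {2 ℕ.^ m} {N} 2^m≤N) ⟩
  log₂ (fromℕ N) * fromℕ g
    ≤⟨ *-monoʳ-≤ {fromℕ g} {log₂ (log₂ (fromℕ d))} (log₂ (fromℕ N)) (log₂-nonneg (fromℕ N))
         (log₂-log₂-≥ (fromℕ d) {e} {g} 2^g≤e λ _ → /1-mono-≤ {2 ℕ.^ e} {d} (ℕₚ.≤-reflexive (sym d≡2^e))) ⟩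
  log₂ (fromℕ N) * log₂ (log₂ (fromℕ d)) ∎)
  where
  open ≤-Reasoning
  c : ℝ
  c = fromℚ 1/20
  0≤c : 0ℝ ≲ c
  0≤c = ≤-pointwise λ _ → ℚₚ.nonNegative⁻¹ 1/20

-- A tail of `x` is bounded by a positive rational, and this by its numerator, as the denominator is
-- at least 1. This replaces the real constant `K` by a natural number.
≤-fromℕ : ∀ x → ∃[ κ ] x ≲ fromℕ κ
≤-fromℕ x = let (B , N , 0<B , h) = bounded x in
  num B , wrap λ ε 0<ε → N , λ n n≥ → begin
    seq x n                     ≤⟨ ≤-abs (seq x n) ⟩
    ℚ.∣ seq x n ∣               ≤⟨ h n n≥ ⟩
    B                           ≤⟨ ≤num (ℚₚ.<⇒≤ 0<B) ⟩
    + num B ℚ./ 1               ≡⟨ ℚₚ.+-identityʳ (+ num B ℚ./ 1) ⟨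
    + num B ℚ./ 1 ℚ.+ 0ℚ        ≤⟨ ℚₚ.+-monoʳ-≤ (+ num B ℚ./ 1) (ℚₚ.<⇒≤ 0<ε) ⟩
    + num B ℚ./ 1 ℚ.+ ε         ∎
  where
  open ℚₚ.≤-Reasoning
  ≤num : ∀ {q} → 0ℚ ℚ.≤ q → q ℚ.≤ + num q ℚ./ 1
  ≤num {q} 0≤q = ℚₚ.toℚᵘ-cancel-≤ (subst₂ ℚᵘ._≤_ (sym (toℚᵘ-num 0≤q)) refl
    (ℚᵘₚ.≤-respʳ-≃ (ℚᵘₚ.≃-sym (ℚₚ.toℚᵘ-fromℚᵘ (ℚᵘ.mkℚᵘ (+ num q) 0)))
      (mkℚᵘ-≤ (ℕₚ.*-monoʳ-≤ (num q) (ℕ.s≤s ℕ.z≤n)))))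

*-log₂-≤ : ∀ {K κ d e} → K ≲ fromℕ κ → d ≡ 2 ℕ.^ e → K * log₂ (fromℕ d) ≲ fromℕ (κ ℕ.* e)
*-log₂-≤ {K} {κ} {d} {e} K≤κ d≡2^e = begin
  K * log₂ (fromℕ d)
    ≤⟨ *-monoˡ-≤ {K} {fromℕ κ} (log₂ (fromℕ d)) (log₂-nonneg (fromℕ d)) K≤κ ⟩
  fromℕ κ * log₂ (fromℕ d)
    ≤⟨ *-monoʳ-≤ {log₂ (fromℕ d)} {fromℕ e} (fromℕ κ) (fromℕ-nonneg κ)
         (log₂-≤ (fromℕ d) {e} λ _ → /1-mono-≤ {d} {2 ℕ.^ e} (ℕₚ.≤-reflexive d≡2^e)) ⟩
  fromℕ κ * fromℕ e
    ≈⟨ fromℕ-* κ e ⟩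
  fromℕ (κ ℕ.* e) ∎
  where open ≤-Reasoning

-- Choice of the parameters.

n<2^n : ∀ n → n ℕ.< 2 ℕ.^ n
n<2^n zero    = ℕ.s≤s ℕ.z≤n
n<2^n (suc n) = ℕₚ.≤-trans (ℕ.s≤s (n<2^n n))
  (ℕₚ.+-mono-≤ (ℕₚ.m^n>0 2 n) (ℕₚ.≤-reflexive (sym (ℕₚ.+-identityʳ (2 ℕ.^ n)))))

-- g plays the role of log log d, and R is about (log d)⁵.
module Family (k : ℕ) where
  g m R : ℕ
  g = suc k
  m = 2 ℕ.^ g
  R = 2 ℕ.^ (5 ℕ.* g)

  1<R : 1 ℕ.< R
  1<R = ℕₚ.^-monoʳ-< 2 (ℕ.s≤s (ℕ.s≤s ℕ.z≤n)) {0} {5 ℕ.* g} (ℕ.s≤s ℕ.z≤n)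

  open Construction R 1<R m public

  dim≡2^ : dim ≡ 2 ℕ.^ (20 ℕ.* (m ℕ.* g))
  dim≡2^ = begin
    (R ℕ.* R) ℕ.^ (m ℕ.* 2)                           ≡⟨ cong (ℕ._^ (m ℕ.* 2)) (sym (ℕₚ.^-distribˡ-+-* 2 (5 ℕ.* g) (5 ℕ.* g))) ⟩
    (2 ℕ.^ (5 ℕ.* g ℕ.+ 5 ℕ.* g)) ℕ.^ (m ℕ.* 2)       ≡⟨ ℕₚ.^-*-assoc 2 (5 ℕ.* g ℕ.+ 5 ℕ.* g) (m ℕ.* 2) ⟩
    2 ℕ.^ ((5 ℕ.* g ℕ.+ 5 ℕ.* g) ℕ.* (m ℕ.* 2))       ≡⟨ cong (2 ℕ.^_) (solve 2 (λ g m →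
                                                           (con 5 :* g :+ con 5 :* g) :* (m :* con 2) := con 20 :* (m :* g)) refl g m) ⟩
    2 ℕ.^ (20 ℕ.* (m ℕ.* g))                          ∎
    where
    open ≡-Reasoning
    open ℕSolver.+-*-Solver

  m≤log₂dim : m ℕ.≤ 20 ℕ.* (m ℕ.* g)
  m≤log₂dim = begin
    m                   ≡⟨ ℕₚ.*-identityʳ m ⟨
    m ℕ.* 1             ≤⟨ ℕₚ.*-monoʳ-≤ m (ℕ.s≤s ℕ.z≤n) ⟩
    m ℕ.* g             ≤⟨ ℕₚ.m≤n*m (m ℕ.* g) 20 ⟩
    20 ℕ.* (m ℕ.* g)    ∎
    where open ℕₚ.≤-Reasoning

  -- As `suc (m * 2)` is at most `3 * m`, the left side is at most `240 * κ * g * m ^ 2`. Both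
  -- `240 * κ` and `g` are at most `m`, which leaves `m ^ 4 < m ^ 5`, and `R` is `m ^ 5`; hence the
  -- 5 in the definition of `R`.
  R-large : ∀ {κ} → 240 ℕ.* κ ℕ.< g → 4 ℕ.* (κ ℕ.* (20 ℕ.* (m ℕ.* g))) ℕ.* suc (m ℕ.* 2) ℕ.< R
  R-large {κ} 240κ<g = begin-strict
    4 ℕ.* (κ ℕ.* (20 ℕ.* (m ℕ.* g))) ℕ.* suc (m ℕ.* 2)
      ≤⟨ ℕₚ.*-monoʳ-≤ (4 ℕ.* (κ ℕ.* (20 ℕ.* (m ℕ.* g)))) (ℕₚ.+-monoˡ-≤ (m ℕ.* 2) 1≤m) ⟩
    4 ℕ.* (κ ℕ.* (20 ℕ.* (m ℕ.* g))) ℕ.* (m ℕ.+ m ℕ.* 2)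
      ≡⟨ solve 3 (λ κ m g → con 4 :* (κ :* (con 20 :* (m :* g))) :* (m :+ m :* con 2) :=
                            con 240 :* κ :* g :* (m :* m)) refl κ m g ⟩
    240 ℕ.* κ ℕ.* g ℕ.* (m ℕ.* m)
      ≤⟨ ℕₚ.*-monoˡ-≤ (m ℕ.* m) (ℕₚ.*-mono-≤ (ℕₚ.≤-trans (ℕₚ.<⇒≤ 240κ<g) g≤m) g≤m) ⟩
    m ℕ.* m ℕ.* (m ℕ.* m)
      ≡⟨ solve 1 (λ m → m :* m :* (m :* m) := m :^ 4) refl m ⟩
    m ℕ.^ 4
      <⟨ ℕₚ.^-monoʳ-< m 1<m {4} {5} ℕₚ.≤-refl ⟩
    m ℕ.^ 5
      ≡⟨ ℕₚ.^-*-assoc 2 g 5 ⟩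
    2 ℕ.^ (g ℕ.* 5)
      ≡⟨ cong (2 ℕ.^_) (ℕₚ.*-comm g 5) ⟩
    R ∎
    where
    open ℕₚ.≤-Reasoning
    open ℕSolver.+-*-Solver
    1≤m : 1 ℕ.≤ m
    1≤m = ℕₚ.m^n>0 2 g
    g≤m : g ℕ.≤ m
    g≤m = ℕₚ.<⇒≤ (n<2^n g)
    1<m : 1 ℕ.< m
    1<m = ℕₚ.≤-<-trans (ℕ.s≤s ℕ.z≤n) (n<2^n g)

  polytope : Pred (ℝ^ dim) 0ℓ
  polytope = ConvexHull vertex

-- The sequence of dimensions and the two lower bounds.

dims : ℕ → ℕ
dims = Family.dim

dims-mono-≤ : ∀ {k l} → k ℕ.≤ l → dims k ℕ.≤ dims l
dims-mono-≤ {k} {l} k≤l = subst₂ ℕ._≤_ (sym (Family.dim≡2^ k)) (sym (Family.dim≡2^ l))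
  (ℕₚ.^-monoʳ-≤ 2 (ℕₚ.*-monoʳ-≤ 20 (ℕₚ.*-mono-≤ (ℕₚ.^-monoʳ-≤ 2 (ℕ.s≤s k≤l)) (ℕ.s≤s k≤l))))

k≤dims : ∀ k → k ℕ.≤ dims k
k≤dims k = begin
  k                          ≤⟨ ℕₚ.n≤1+n k ⟩
  suc k                      ≤⟨ ℕₚ.<⇒≤ (n<2^n (suc k)) ⟩
  2 ℕ.^ suc k                ≤⟨ Family.m≤log₂dim k ⟩
  20 ℕ.* (2 ℕ.^ suc k ℕ.* suc k) ≤⟨ ℕₚ.<⇒≤ (n<2^n (20 ℕ.* (2 ℕ.^ suc k ℕ.* suc k))) ⟩
  2 ℕ.^ (20 ℕ.* (2 ℕ.^ suc k ℕ.* suc k)) ≡⟨ Family.dim≡2^ k ⟨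
  dims k                     ∎
  where open ℕₚ.≤-Reasoning

-- A portfolio for a larger class must still serve the ordered norms of the construction, so one
-- argument settles both classes.
portfolioLowerBound : ∀ (𝐂 : ∀ d → Pred (ℝ^ d → ℝ) 0ℓ) → (∀ d → IsOrderedNorm d ⊆ 𝐂 d) →
  PortfolioLowerBound 𝐂 dims Family.polytope
portfolioLowerBound 𝐂 ordered⊆𝐂 K 0<K =
  fromℚ 1/20 , (1/20 , ℚₚ.positive⁻¹ 1/20 , 0 , λ _ _ → ℚₚ.≤-reflexive (ℚₚ.+-identityˡ 1/20)) ,
  -- As `dims` is monotone, a dimension above `dims (240 * κ)` forces `k` above `240 * κ`, which
  -- provides the hypothesis of `R-large`.
  suc (dims (240 ℕ.* κ)) , λ k d₀≤ X isPortfolio N hasSize →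
    sizeBound {dims k} {N} {Family.m k} {Family.g k} (Family.dim≡2^ k) refl
      (Family.portfolio-size k {A = κ ℕ.* (20 ℕ.* (Family.m k ℕ.* Family.g k))}
        (*-log₂-≤ {K} {κ} (proj₂ (≤-fromℕ K)) (Family.dim≡2^ k)) (Family.R-large k {κ} (large d₀≤))
        (ordered⊆𝐂 (dims k)) isPortfolio hasSize)
      (Family.m≤log₂dim k)
  where
  κ : ℕ
  κ = proj₁ (≤-fromℕ K)
  large : ∀ {k} → dims (240 ℕ.* κ) ℕ.< dims k → 240 ℕ.* κ ℕ.< suc k
  large h = ℕₚ.m<n⇒m<1+n (ℕₚ.≰⇒> λ k≤ → ℕₚ.<⇒≱ h (dims-mono-≤ k≤))

theorem5 : Σ[ dim ∈ (ℕ → ℕ) ] Σ[ 𝒟 ∈ (∀ k → Pred (ℝ^ (dim k)) 0ℓ) ]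
    TendsToInfinity dim
    × (∀ k → IsPolytope (𝒟 k))
    × (∀ k → 𝒟 k ⊆ (0ᵛ ≤ᵛ_))
    × PortfolioLowerBound IsOrderedNorm dim 𝒟
    × PortfolioLowerBound IsSymmetricMonotonicNorm dim 𝒟
theorem5 =
  dims , Family.polytope ,
  (λ M → M , λ k M≤k → ℕₚ.≤-trans M≤k (k≤dims k)) ,
  (λ k → _ , Family.vertex k , λ x → ⇔-id (x ∈ Family.polytope k)) ,
  (λ k {x} x∈ i → unwrap (hull-nonneg {v = Family.vertex k} {x} (Family.vertex-nonneg k) x∈ i)) ,
  portfolioLowerBound IsOrderedNorm (λ d f → f) ,
  portfolioLowerBound IsSymmetricMonotonicNorm (λ d f → ordered⇒symmetricMonotonic f)
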